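{- Let $m\ge 4$ be even, $n=2^m-1$, let $i_1\neq i_2$ in $\{0,1,2,3\}$, and let $\mathcal{C}=\mathcal{C}_{i_1,i_2}$ be the binary code with parity check matrix $H_m(\mathbf{v}_{i_1,i_2})$. \begin{itemize} \item If $\{i_1,i_2\}=\{0,1\}$ or $\{0,3\}$, then $\mathcal{C}$ is a non-antipodal completely transitive code with covering radius $\rho=3$ and intersection array $(n,(n-3)/2,1;\,1,(n-3)/2,n)$. \item If $\{i_1,i_2\}=\{1,2\}$ or $\{2,3\}$, then $\mathcal{C}$ is an antipodal completely transitive code with covering radius $\rho=3$ and intersection array $(n,(n+1)/2,1;\,1,(n+1)/2,n)$. \item If $\{i_1,i_2\}=\{0,2\}$, then $\mathcal{C}$ is the even-weight subcode of the Hamming code, i.e. a completely transitive $[n,n-m-1,4]$ code with covering radius $\rho=3$. \item If $\{i_1,i_2\}=\{1,3\}$, then $\mathcal{C}$ is the Hamming code $\mathcal{H}_m$. \end{itemize}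
   Context: $\mathbb{F}_2$ is the binary field. Let $m\ge 4$ be even and $n=2^m-1$. Let $\alpha$ be a primitive element of $GF(2^m)$ and let $H_m$ be the $m\times n$ binary matrix whose $i$-th column $\mathbf{h}_i$ ($i=0,\dots,n-1$) is the coordinate vector of $\alpha^i$ with respect to the basis $1,\alpha,\dots,\alpha^{m-1}$; thus the columns of $H_m$ are exactly the nonzero vectors of $\mathbb{F}_2^m$, and $H_m$ is a parity check matrix of the binary Hamming code $\mathcal{H}_m$ (an $[n,n-m,3]$ code). For distinct $i_1,i_2\in\{0,1,2,3\}$ let $\mathbf{v}_{i_1,i_2}=(v_0,\dots,v_{n-1})$ where $v_i=1$ if the Hamming weight $\mathrm{wt}(\mathbf{h}_i)\equiv i_1$ or $i_2 \pmod 4$, and $v_i=0$ otherwise. $H_m(\mathbf{v}_{i_1,i_2})$ is $H_m$ with the row $\mathbf{v}_{i_1,i_2}$ appended, and $\mathcal{C}_{i_1,i_2}$ is the code with this parity check matrix. For a binary linear code $C$: $d(\mathbf{v},C)$ is the minimum Hamming distance from $\mathbf{v}$ to $C$, $\rho=\max_{\mathbf{v}}d(\mathbf{v},C)$ is the covering radius, and $C(l)=\{\mathbf{x}: d(\mathbf{x},C)=l\}$. $C$ is completely regular if for every $l$, every $\mathbf{x}\in C(l)$ has the same number $c_l$ of neighbors (vectors at Hamming distance 1) in $C(l-1)$ and the same number $b_l$ of neighbors in $C(l+1)$; its intersection array is $(b_0,\dots,b_{\rho-1};c_1,\dots,c_\rho)$. $\mathrm{Aut}(C)$ is the group of coordinate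 permutations preserving $C$, acting on cosets by $\pi(C+\mathbf{v})=C+\pi(\mathbf{v})$; $C$ is completely transitive if $\mathrm{Aut}(C)$ has exactly $\rho+1$ orbits on the cosets of $C$ (completely transitive codes are completely regular). A binary code is called antipodal if the complement of every codeword is a codeword (for a linear code: the all-one vector belongs to the code). -}

module Defs where

open import Data.Bool using (Bool; true; false; _∧_; _∨_; not; _xor_; if_then_else_)
open import Data.Nat using (ℕ; zero; suc; _+_; _*_; _∸_; _^_; _≤_; _<_; _⊓_; _⊔_; _≡ᵇ_; _%_)
open import Data.Fin using (Fin; toℕ)
open import Data.Fin.Permutation using (Permutation′; _⟨$⟩ˡ_)
open import Data.Vec using (Vec; []; _∷_; replicate; tabulate; lookup; zipWith; updateAt)
import Data.List as L
open import Data.List using (List)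
open import Data.Product using (Σ; ∃; ∃₂; _×_; _,_)
open import Data.Sum using (_⊎_)
open import Relation.Binary.PropositionalEquality using (_≡_; _≢_)

Word : ℕ → Set
Word k = Vec Bool k

zeros : ∀ {k} → Word k
zeros {k} = replicate k false

ones : ∀ {k} → Word k
ones {k} = replicate k true

_⊕_ : ∀ {k} → Word k → Word k → Word k
_⊕_ = zipWith _xor_

wt : ∀ {k} → Word k → ℕ
wt [] = 0
wt (true ∷ xs) = suc (wt xs)
wt (false ∷ xs) = wt xs

ham : ∀ {k} → Word k → Word k → ℕ
ham x y = wt (x ⊕ y)

isZero : ∀ {k} → Word k → Bool
isZero [] = true
isZero (b ∷ xs) = not b ∧ isZero xs

allWords : (k : ℕ) → List (Word k)
allWords zero = [] L.∷ L.[]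
allWords (suc k) = L.map (false ∷_) (allWords k) L.++ L.map (true ∷_) (allWords k)

-- flip coordinate i (the neighbours of x are exactly flip x i, i : Fin n)
flipAt : ∀ {k} → Word k → Fin k → Word k
flipAt x i = updateAt x i not

-- The field GF(2^m) realised as F_2[x]/(p(x)), p monic of degree m,
-- p(x) = x^m + c_{m-1} x^{m-1} + ... + c_0 ; c = (c_0,...,c_{m-1}).
-- Elements are coordinate vectors w.r.t. the basis 1, x, ..., x^{m-1}
-- (index j = coefficient of x^j); alpha = x.

shiftIn : ∀ {k} → Bool → Word k → Word k × Bool
shiftIn b [] = [] , b
shiftIn b (x ∷ xs) with shiftIn x xs
... | ys , top = (b ∷ ys) , top

mulα : ∀ {m} → Word m → Word m → Word m
mulα c v with shiftIn false v
... | ys , top = if top then ys ⊕ c else ys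

oneF : ∀ {m} → Word m
oneF {zero} = []
oneF {suc m} = true ∷ zeros

powα : ∀ {m} → Word m → ℕ → Word m
powα c zero = oneF
powα c (suc i) = mulα c (powα c i)

-- alpha = x is a primitive element: multiplicative order exactly 2^m - 1
-- (equivalently p is a primitive polynomial, so F_2[x]/(p) = GF(2^m))
IsPrimitive : ∀ {m} → Word m → Set
IsPrimitive {m} c =
  powα c (2 ^ m ∸ 1) ≡ oneF × (∀ i → 0 < i → i < 2 ^ m ∸ 1 → powα c i ≢ oneF)

Code : ℕ → Set
Code n = Word n → Bool

kernel : ∀ {n r} → (Fin n → Word r) → Code n
kernel {n} col x =
  isZero (L.foldr (λ i acc → if lookup x i then col i ⊕ acc else acc) zeros (L.allFin n))

hcol : ∀ {m} → Word m → Fin (2 ^ m ∸ 1) → Word m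
hcol c i = powα c (toℕ i)

hamming : ∀ {m} → Word m → Code (2 ^ m ∸ 1)
hamming c = kernel (hcol c)

vRow : ∀ {m} → Word m → ℕ → ℕ → Word (2 ^ m ∸ 1)
vRow c i₁ i₂ = tabulate λ i → ((wt (hcol c i) % 4) ≡ᵇ i₁) ∨ ((wt (hcol c i) % 4) ≡ᵇ i₂)

-- C_{i1,i2}: parity check matrix H_m(v) = H_m with row v appended
-- (column i of H_m(v) is h_i extended by v_i)
codeC : ∀ {m} → Word m → ℕ → ℕ → Code (2 ^ m ∸ 1)
codeC c i₁ i₂ = kernel (λ i → lookup (vRow c i₁ i₂) i ∷ hcol c i)

-- d(x, C) = min_{y ∈ C} ham x y  (for nonempty C; all distances are ≤ n)
dist : ∀ {n} → Code n → Word n → ℕ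
dist {n} C x = L.foldr _⊓_ n (L.map (λ y → if C y then ham x y else n) (allWords n))

coveringRadius : ∀ {n} → Code n → ℕ
coveringRadius {n} C = L.foldr _⊔_ 0 (L.map (dist C) (allWords n))

nbrsIn : ∀ {n} → Code n → Word n → ℕ → ℕ
nbrsIn {n} C x l = L.length (L.filterᵇ (λ i → dist C (flipAt x i) ≡ᵇ l) (L.allFin n))

-- C is completely regular with intersection array (b_0..b_{ρ-1}; c_1..c_ρ)
-- (lookup b l = b_l, lookup cs l = c_{l+1})
HasIntersectionArray : ∀ {n ρ} → Code n → Vec ℕ ρ → Vec ℕ ρ → Set
HasIntersectionArray {n} {ρ} C b cs =
  coveringRadius C ≡ ρ
  × (∀ (x : Word n) (l : Fin ρ) → dist C x ≡ toℕ l →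
       nbrsIn C x (suc (toℕ l)) ≡ lookup b l)
  × (∀ (x : Word n) (l : Fin ρ) → dist C x ≡ suc (toℕ l) →
       nbrsIn C x (toℕ l) ≡ lookup cs l)

permute : ∀ {n} → Permutation′ n → Word n → Word n
permute π x = tabulate λ j → lookup x (π ⟨$⟩ˡ j)

IsAut : ∀ {n} → Code n → Permutation′ n → Set
IsAut {n} C π = ∀ (x : Word n) → C (permute π x) ≡ C x

-- cosets C+v and C+w lie in the same Aut(C)-orbit: π(C+v) = C+w for some π ∈ Aut(C)
SameOrbit : ∀ {n} → Code n → Word n → Word n → Set
SameOrbit {n} C v w = Σ (Permutation′ n) λ π → IsAut C π × C (permute π v ⊕ w) ≡ true

-- Aut(C) has exactly ρ+1 orbits on the cosets of C
CompletelyTransitive : ∀ {n} → Code n → Set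
CompletelyTransitive {n} C =
  Σ (Vec (Word n) (suc (coveringRadius C))) λ reps →
    (∀ i j → SameOrbit C (lookup reps i) (lookup reps j) → i ≡ j)
    × (∀ (v : Word n) → ∃ λ i → SameOrbit C v (lookup reps i))

Antipodal : ∀ {n} → Code n → Set
Antipodal C = C ones ≡ true

NonAntipodal : ∀ {n} → Code n → Set
NonAntipodal C = C ones ≡ false

size : ∀ {n} → Code n → ℕ
size {n} C = L.length (L.filterᵇ C (allWords n))

MinDistance : ∀ {n} → Code n → ℕ → Set
MinDistance {n} C d =
  (∃₂ λ (x y : Word n) → C x ≡ true × C y ≡ true × x ≢ y × ham x y ≡ d)
  × (∀ (x y : Word n) → C x ≡ true → C y ≡ true → x ≢ y → d ≤ ham x y)

IsNKD : ∀ {n} → Code n → ℕ → ℕ → Set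
IsNKD C k d = size C ≡ 2 ^ k × MinDistance C d

evenHamming : ∀ {m} → Word m → Code (2 ^ m ∸ 1)
evenHamming c x = hamming c x ∧ ((wt x % 2) ≡ᵇ 0)

PairIs : ℕ → ℕ → ℕ → ℕ → Set
PairIs i₁ i₂ a b = (i₁ ≡ a × i₂ ≡ b) ⊎ (i₁ ≡ b × i₂ ≡ a)

{-# OPTIONS --safe #-}
-- The two low binary digits of wt(h) are the elementary symmetric polynomials e₁(h), e₂(h) over 𝔽₂, so
-- each row v_{i₁,i₂} is a function v = a + b e₁ + c e₂ on 𝔽₂ᵐ.  The polar form B(x,y) = e₁(x)e₁(y) + x·y of
-- e₂ is nondegenerate because m is even, and v(x+y) = v(x) + v(y) + a + c B(x,y).
-- Unless v is linear, the coset weight of a syndrome depends only on which of four classes contains it: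
-- (0,0), (v(x),x), (v(x)+1,x) with x ≠ 0, and (1,0) have weights 0, 1, 2, 3.  The intersection numbers then
-- count the y with B(x,y) prescribed.  The transvections x ↦ x + B(x,u)u change v by a linear form, hence lift
-- to automorphisms of the code, and two of them suffice to carry any nonzero x to any other; so these four
-- classes are exactly the orbits on cosets.
module Submission where

open import Defs
open import Level using (0ℓ)
open import Algebra.Bundles using (CommutativeMonoid)
import Algebra.Properties.CommutativeMonoid.Sum as Sum
open import Data.Bool as Bool using (Bool; true; false; _∧_; _∨_; not; _xor_; if_then_else_)
open import Data.Bool.Properties
  using (T-≡; xor-assoc; xor-comm; xor-same; xor-identityˡ; xor-identityʳ; ∧-comm; ∧-zeroʳ; ∧-identityʳ; ∨-comm)
open import Data.Bool.Solver using (module xor-∧-Solver)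
open import Data.Fin as Fin using (Fin; zero; suc; toℕ)
open import Data.Fin.Permutation
  using (Permutation′; permutation; _⟨$⟩ʳ_; _⟨$⟩ˡ_; flip; _∘ₚ_; inverseˡ; inverseʳ)
  renaming (id to idₚ)
open import Data.Fin.Properties using (any?; toℕ<n; toℕ-injective; finToFun-funToFin; injective⇒≤)
open import Data.List as L using (List; allFin; filterᵇ; length)
open import Data.List.Membership.Propositional using (_∈_)
open import Data.List.Membership.Propositional.Properties
  using (∈-map⁺; ∈-map⁻; ∈-++⁺ˡ; ∈-++⁺ʳ; ∈-filter⁺; ∈-filter⁻; ∈-allFin
        ; ∈-cartesianProductWith⁺; ∈-cartesianProductWith⁻)
open import Data.List.Membership.Propositional.Properties.WithK using (unique∧set⇒bag)
open import Data.List.Properties using (length-map; length-++; length-tabulate; map-∘; map-cong; map-tabulate)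
open import Data.List.Relation.Binary.BagAndSetEquality using (∼bag⇒↭)
open import Data.List.Relation.Binary.Permutation.Propositional as Perm using (_↭_)
open import Data.List.Relation.Binary.Permutation.Propositional.Properties
  using (↭-length) renaming (map⁺ to ↭-map⁺)
open import Data.List.Relation.Unary.All as All using ([])
open import Data.List.Relation.Unary.AllPairs using ([]; _∷_)
open import Data.List.Relation.Unary.Any using (here; there)
open import Data.List.Relation.Unary.Unique.Propositional using (Unique)
open import Data.List.Relation.Unary.Unique.Propositional.Properties
  using (map⁺; ++⁺; cartesianProductWith⁺; filter⁺; allFin⁺)
open import Data.Nat
  using (ℕ; zero; suc; _+_; _*_; _∸_; _^_; _≤_; _<_; _%_; _/_; _⊓_; _⊔_; _≡ᵇ_; z≤n; s≤s)
open import Data.Nat.DivMod using ([m+kn]%n≡m%n; m*n/n≡m)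
open import Data.Nat.Properties as ℕ using ()
open import Data.Product using (_×_; _,_; ∃; ∃₂; Σ; proj₁; proj₂)
open import Data.Sum using (_⊎_; inj₁; inj₂)
open import Data.Vec using (Vec; _∷_; []; lookup; tabulate)
open import Data.Vec.Properties
  using (≡-dec; ∷-injectiveʳ; zipWith-assoc; zipWith-comm; zipWith-identityˡ; lookup-zipWith
        ; lookup-map; lookup-replicate; lookup∘tabulate; lookup∘updateAt; lookup∘updateAt′
        ; tabulate∘lookup; tabulate-cong)
open import Function using (_∘_; id; mk⇔; Equivalence)
open import Algebra.Properties.CommutativeSemigroup ℕ.+-commutativeSemigroup using (interchange)
open import Relation.Binary.Definitions using (tri<; tri≈; tri>)
open import Relation.Binary.PropositionalEquality
open import Relation.Nullary using (contradiction; yes; no; Dec)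
open import Relation.Nullary.Decidable using (T?)
open xor-∧-Solver using (solve; _:+_; _:*_; _:=_)

-- Rows that differ by e₁, the sum of the rows of H_m, give the same code; this pairs {0,1} with
-- {0,3} and {1,2} with {2,3}, and leaves the four cases of (a, c). All parameters come from κ(x,y)
-- = a + c B(x,y) = v(x) + v(y) + v(x+y), which tells whether the sum of two distinct columns misses
-- the set of columns. In counting the y with κ(x,y) = 1, the vector 0 must be left out because it
-- is not a column, and x because x + x = 0. Both are orthogonal to x: for κ = 1 + B they cost 2 of
-- the 2^(m-1) solutions, for κ = B they cost nothing, and this is the difference between (n-3)/2
-- and (n+1)/2. For {0,2}, κ is constantly 1, so the even-weight code runs through the same argument
-- although its row is affine; only {1,3}, where κ = 0, is separate. Antipodality is read off a: the
-- columns sum to (a,0), since all (v(w),w) sum to 0 and the sum over columns misses (v(0),0).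

⊕-assoc : ∀ {k} (x y z : Word k) → (x ⊕ y) ⊕ z ≡ x ⊕ (y ⊕ z)
⊕-assoc = zipWith-assoc xor-assoc

⊕-comm : ∀ {k} (x y : Word k) → x ⊕ y ≡ y ⊕ x
⊕-comm = zipWith-comm xor-comm

⊕-identityˡ : ∀ {k} (x : Word k) → zeros ⊕ x ≡ x
⊕-identityˡ = zipWith-identityˡ xor-identityˡ

⊕-identityʳ : ∀ {k} (x : Word k) → x ⊕ zeros ≡ x
⊕-identityʳ x = trans (⊕-comm x zeros) (⊕-identityˡ x)

⊕-self : ∀ {k} (x : Word k) → x ⊕ x ≡ zeros
⊕-self []      = refl
⊕-self (b ∷ x) = cong₂ _∷_ (xor-same b) (⊕-self x)

⊕-cancelˡ : ∀ {k} (x y : Word k) → x ⊕ (x ⊕ y) ≡ y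
⊕-cancelˡ x y = begin
  x ⊕ (x ⊕ y)  ≡⟨ ⊕-assoc x x y ⟨
  (x ⊕ x) ⊕ y  ≡⟨ cong (_⊕ y) (⊕-self x) ⟩
  zeros ⊕ y    ≡⟨ ⊕-identityˡ y ⟩
  y            ∎
  where open ≡-Reasoning

⊕-cancelʳ : ∀ {k} (x y : Word k) → (x ⊕ y) ⊕ y ≡ x
⊕-cancelʳ x y = trans (⊕-assoc x y y) (trans (cong (x ⊕_) (⊕-self y)) (⊕-identityʳ x))

⊕-≡zeros : ∀ {k} {x y : Word k} → x ⊕ y ≡ zeros → x ≡ y
⊕-≡zeros {x = x} {y} p = begin
  x            ≡⟨ ⊕-cancelʳ x y ⟨
  (x ⊕ y) ⊕ y  ≡⟨ cong (_⊕ y) p ⟩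
  zeros ⊕ y    ≡⟨ ⊕-identityˡ y ⟩
  y            ∎
  where open ≡-Reasoning

⊕-interchange : ∀ {k} (a b c d : Word k) → (a ⊕ b) ⊕ (c ⊕ d) ≡ (a ⊕ c) ⊕ (b ⊕ d)
⊕-interchange []       []       []       []       = refl
⊕-interchange (a ∷ as) (b ∷ bs) (c ∷ cs) (d ∷ ds) =
  cong₂ _∷_ (solve 4 (λ a b c d → (a :+ b) :+ (c :+ d) := (a :+ c) :+ (b :+ d)) refl a b c d)
            (⊕-interchange as bs cs ds)

isZero⇒≡ : ∀ {k} {x : Word k} → isZero x ≡ true → x ≡ zeros
isZero⇒≡ {x = []}        _ = refl
isZero⇒≡ {x = false ∷ x} p = cong (false ∷_) (isZero⇒≡ p)

isZero-zeros : ∀ k → isZero (zeros {k}) ≡ true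
isZero-zeros zero    = refl
isZero-zeros (suc k) = isZero-zeros k

≡⇒isZero : ∀ {k} {x : Word k} → x ≡ zeros → isZero x ≡ true
≡⇒isZero {k} refl = isZero-zeros k

≢⇒isZero : ∀ {k} {x : Word k} → x ≢ zeros → isZero x ≡ false
≢⇒isZero {x = x} x≢0 with isZero x in eq
... | true  = contradiction (isZero⇒≡ eq) x≢0
... | false = refl

isZero⇒≢ : ∀ {k} {x : Word k} → isZero x ≡ false → x ≢ zeros
isZero⇒≢ {k} p refl with () ← trans (sym p) (isZero-zeros k)

infixr 25 _·_

_·_ : ∀ {k} → Bool → Word k → Word k
b · w = if b then w else zeros

·-xor : ∀ {k} b b′ (w : Word k) → (b xor b′) · w ≡ b · w ⊕ b′ · w
·-xor false b′    w = sym (⊕-identityˡ (b′ · w))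
·-xor true  false w = sym (⊕-identityʳ w)
·-xor true  true  w = sym (⊕-self w)

-- Low binary digits of the weight and their polar form.

-- The elementary symmetric polynomials over 𝔽₂: the two low binary digits of the weight.
e₁ e₂ : ∀ {k} → Word k → Bool
e₁ []      = false
e₁ (b ∷ x) = b xor e₁ x
e₂ []      = false
e₂ (b ∷ x) = (b ∧ e₁ x) xor e₂ x

dot : ∀ {k} → Word k → Word k → Bool
dot []      []      = false
dot (a ∷ x) (b ∷ y) = (a ∧ b) xor dot x y

polar : ∀ {k} → Word k → Word k → Bool
polar x y = (e₁ x ∧ e₁ y) xor dot x y

bit : Bool → ℕ
bit b = if b then 1 else 0

-- Prepending a one is binary addition of 1: the recursion of `e₂` adds the carry out of `e₁`, and
-- when both digits are 1 the carry passes on into q.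
wt-digits : ∀ {k} (x : Word k) → ∃ λ q → wt x ≡ (bit (e₁ x) + bit (e₂ x) * 2) + q * 4
wt-digits []          = 0 , refl
wt-digits (false ∷ x) = wt-digits x
wt-digits (true ∷ x) with e₁ x | e₂ x | wt-digits x
... | false | false | q , p = q , cong suc p
... | false | true  | q , p = q , cong suc p
... | true  | false | q , p = q , cong suc p
... | true  | true  | q , p = suc q , cong suc p

wt%4 : ∀ {k} (x : Word k) → wt x % 4 ≡ (bit (e₁ x) + bit (e₂ x) * 2) % 4
wt%4 x with q , p ← wt-digits x = trans (cong (_% 4) p) ([m+kn]%n≡m%n (bit (e₁ x) + bit (e₂ x) * 2) q 4)

e₁-⊕ : ∀ {k} (x y : Word k) → e₁ (x ⊕ y) ≡ e₁ x xor e₁ y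
e₁-⊕ []      []      = refl
e₁-⊕ (a ∷ x) (b ∷ y) rewrite e₁-⊕ x y =
  solve 4 (λ a b c d → (a :+ b) :+ (c :+ d) := (a :+ c) :+ (b :+ d)) refl a b (e₁ x) (e₁ y)

e₁-zeros : ∀ k → e₁ (zeros {k}) ≡ false
e₁-zeros zero    = refl
e₁-zeros (suc k) = e₁-zeros k

e₂-zeros : ∀ k → e₂ (zeros {k}) ≡ false
e₂-zeros zero    = refl
e₂-zeros (suc k) = e₂-zeros k

-- `e₂` is the quadratic form Σ_{i<j} x_i x_j. Its cross terms Σ_{i≠j} x_i y_j are the whole product
-- e₁(x) e₁(y) without the diagonal x·y.
e₂-⊕ : ∀ {k} (x y : Word k) → e₂ (x ⊕ y) ≡ (e₂ x xor e₂ y) xor polar x y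
e₂-⊕ []      []      = refl
e₂-⊕ (a ∷ x) (b ∷ y) rewrite e₁-⊕ x y | e₂-⊕ x y =
  solve 7 (λ a b p q s t d →
    (a :+ b) :* (p :+ q) :+ ((s :+ t) :+ (p :* q :+ d))
    := ((a :* p :+ s) :+ (b :* q :+ t)) :+ ((a :+ p) :* (b :+ q) :+ (a :* b :+ d)))
    refl a b (e₁ x) (e₁ y) (e₂ x) (e₂ y) (dot x y)

dot-comm : ∀ {k} (x y : Word k) → dot x y ≡ dot y x
dot-comm []      []      = refl
dot-comm (a ∷ x) (b ∷ y) = cong₂ _xor_ (∧-comm a b) (dot-comm x y)

dot-⊕ʳ : ∀ {k} (x y z : Word k) → dot x (y ⊕ z) ≡ dot x y xor dot x z
dot-⊕ʳ []      []      []      = refl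
dot-⊕ʳ (a ∷ x) (b ∷ y) (c ∷ z) rewrite dot-⊕ʳ x y z =
  solve 5 (λ a b c p q → a :* (b :+ c) :+ (p :+ q) := (a :* b :+ p) :+ (a :* c :+ q))
    refl a b c (dot x y) (dot x z)

dot-self : ∀ {k} (x : Word k) → dot x x ≡ e₁ x
dot-self []          = refl
dot-self (false ∷ x) = dot-self x
dot-self (true ∷ x)  = cong not (dot-self x)

dot-zeros : ∀ {k} (x : Word k) → dot x zeros ≡ false
dot-zeros []          = refl
dot-zeros (false ∷ x) = dot-zeros x
dot-zeros (true ∷ x)  = dot-zeros x

dot-ones : ∀ {k} (x : Word k) → dot ones x ≡ e₁ x
dot-ones []      = refl
dot-ones (a ∷ x) = cong (a xor_) (dot-ones x)

dot-nonzero : ∀ {k} (x : Word k) → x ≢ zeros → ∃ λ y → dot x y ≡ true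
dot-nonzero []          x≢0 = contradiction refl x≢0
dot-nonzero (true ∷ x)  _   = true ∷ zeros , cong not (dot-zeros x)
dot-nonzero (false ∷ x) x≢0 with y , p ← dot-nonzero x (λ q → x≢0 (cong (false ∷_) q)) = false ∷ y , p

polar-sym : ∀ {k} (x y : Word k) → polar x y ≡ polar y x
polar-sym x y = cong₂ _xor_ (∧-comm (e₁ x) (e₁ y)) (dot-comm x y)

polar-⊕ʳ : ∀ {k} (x y z : Word k) → polar x (y ⊕ z) ≡ polar x y xor polar x z
polar-⊕ʳ x y z rewrite e₁-⊕ y z | dot-⊕ʳ x y z =
  solve 5 (λ a b c p q → a :* (b :+ c) :+ (p :+ q) := (a :* b :+ p) :+ (a :* c :+ q))
    refl (e₁ x) (e₁ y) (e₁ z) (dot x y) (dot x z)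

polar-⊕ˡ : ∀ {k} (x y z : Word k) → polar (x ⊕ y) z ≡ polar x z xor polar y z
polar-⊕ˡ x y z = begin
  polar (x ⊕ y) z            ≡⟨ polar-sym (x ⊕ y) z ⟩
  polar z (x ⊕ y)            ≡⟨ polar-⊕ʳ z x y ⟩
  polar z x xor polar z y    ≡⟨ cong₂ _xor_ (polar-sym z x) (polar-sym z y) ⟩
  polar x z xor polar y z    ∎
  where open ≡-Reasoning

polar-self : ∀ {k} (x : Word k) → polar x x ≡ false
polar-self x rewrite dot-self x with e₁ x
... | false = refl
... | true  = refl

polar-zerosʳ : ∀ {k} (x : Word k) → polar x zeros ≡ false
polar-zerosʳ {k} x rewrite e₁-zeros k | dot-zeros x with e₁ x
... | false = refl
... | true  = refl

e₁-ones : ∀ k → k % 2 ≡ 0 → e₁ (ones {k}) ≡ false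
e₁-ones zero          _ = refl
e₁-ones (suc (suc k)) p rewrite e₁-ones k p = refl

-- Because e₁(y) is the dot product of y with the all-one word, the form is the dot product twisted
-- by the linear map x ↦ x + e₁(x)·1. Nondegeneracy thus becomes injectivity of that map.
polar-as-dot : ∀ {k} (x y : Word k) → dot (x ⊕ e₁ x · ones) y ≡ polar x y
polar-as-dot x y with e₁ x
... | false = cong (λ z → dot z y) (⊕-identityʳ x)
... | true  = begin
  dot (x ⊕ ones) y       ≡⟨ dot-comm (x ⊕ ones) y ⟩
  dot y (x ⊕ ones)       ≡⟨ dot-⊕ʳ y x ones ⟩
  dot y x xor dot y ones ≡⟨ cong₂ _xor_ (dot-comm y x) (trans (dot-comm y ones) (dot-ones y)) ⟩
  dot x y xor e₁ y       ≡⟨ xor-comm (dot x y) (e₁ y) ⟩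
  e₁ y xor dot x y       ∎
  where open ≡-Reasoning

polar-nondegenerate : ∀ {k} → k % 2 ≡ 0 → (x : Word k) → x ≢ zeros → ∃ λ y → polar x y ≡ true
polar-nondegenerate {k} even x x≢0 =
  let y , p = dot-nonzero (x ⊕ e₁ x · ones) φx≢0 in y , trans (sym (polar-as-dot x y)) p
  where
  φx≢0 : x ⊕ e₁ x · ones ≢ zeros
  φx≢0 p with e₁ x in eq
  ... | false = x≢0 (trans (sym (⊕-identityʳ x)) p)
  -- Here x would be the all-one word with `e₁` equal to 1, but the all-one word of even length has
  -- `e₁` equal to 0.
  ... | true with () ← trans (sym eq) (trans (cong e₁ (⊕-≡zeros p)) (e₁-ones k even))

-- Two hyperplanes never cover the space: if p lies off the first but on the second, and q the other
-- way round, then p ⊕ q lies off both.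
polar-common : ∀ {k} → k % 2 ≡ 0 → (x y : Word k) → x ≢ zeros → y ≢ zeros →
  ∃ λ z → polar x z ≡ true × polar y z ≡ true
polar-common even x y x≢0 y≢0
  with p , xp ← polar-nondegenerate even x x≢0
  with q , yq ← polar-nondegenerate even y y≢0
  with polar y p in yp | polar x q in xq
... | true  | _     = p , xp , yp
... | false | true  = q , xq , yq
... | false | false = p ⊕ q
  , trans (polar-⊕ʳ x p q) (cong₂ _xor_ xp xq)
  , trans (polar-⊕ʳ y p q) (cong₂ _xor_ yp yq)

-- Counting over lists and over all words.

count : ∀ {A : Set} → (A → Bool) → List A → ℕ
count P L.[]       = 0
count P (x L.∷ xs) = bit (P x) + count P xs

length-filterᵇ : ∀ {A : Set} (P : A → Bool) xs → length (filterᵇ P xs) ≡ count P xs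
length-filterᵇ P L.[] = refl
length-filterᵇ P (x L.∷ xs) with P x
... | true  = cong suc (length-filterᵇ P xs)
... | false = length-filterᵇ P xs

module _ {A : Set} where

  count-cong : {P Q : A → Bool} → (∀ x → P x ≡ Q x) → ∀ xs → count P xs ≡ count Q xs
  count-cong P≗Q L.[]       = refl
  count-cong P≗Q (x L.∷ xs) = cong₂ _+_ (cong bit (P≗Q x)) (count-cong P≗Q xs)

  count-map : ∀ {B : Set} (P : B → Bool) (f : A → B) xs → count P (L.map f xs) ≡ count (P ∘ f) xs
  count-map P f L.[]       = refl
  count-map P f (x L.∷ xs) = cong (bit (P (f x)) +_) (count-map P f xs)

  count-++ : (P : A → Bool) → ∀ xs ys → count P (xs L.++ ys) ≡ count P xs + count P ys
  count-++ P L.[]       ys = refl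
  count-++ P (x L.∷ xs) ys =
    trans (cong (bit (P x) +_) (count-++ P xs ys)) (sym (ℕ.+-assoc (bit (P x)) _ _))

  count-↭ : (P : A → Bool) → ∀ {xs ys} → xs ↭ ys → count P xs ≡ count P ys
  count-↭ P Perm.refl          = refl
  count-↭ P (Perm.prep x p)    = cong (bit (P x) +_) (count-↭ P p)
  count-↭ P (Perm.swap {xs} {ys} x y p) = begin
    bit (P x) + (bit (P y) + count P xs)  ≡⟨ ℕ.+-assoc (bit (P x)) _ _ ⟨
    bit (P x) + bit (P y) + count P xs    ≡⟨ cong₂ _+_ (ℕ.+-comm (bit (P x)) (bit (P y))) (count-↭ P p) ⟩
    bit (P y) + bit (P x) + count P ys    ≡⟨ ℕ.+-assoc (bit (P y)) _ _ ⟩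
    bit (P y) + (bit (P x) + count P ys)  ∎
    where open ≡-Reasoning
  count-↭ P (Perm.trans p q)   = trans (count-↭ P p) (count-↭ P q)

  count-disjoint : (P Q R : A → Bool) → (∀ x → bit (P x) + bit (Q x) ≡ bit (R x)) →
    ∀ xs → count P xs + count Q xs ≡ count R xs
  count-disjoint P Q R eq L.[]       = refl
  count-disjoint P Q R eq (x L.∷ xs) = begin
    (bit (P x) + count P xs) + (bit (Q x) + count Q xs)
      ≡⟨ interchange (bit (P x)) (count P xs) (bit (Q x)) (count Q xs) ⟩
    (bit (P x) + bit (Q x)) + (count P xs + count Q xs)
      ≡⟨ cong₂ _+_ (eq x) (count-disjoint P Q R eq xs) ⟩
    bit (R x) + count R xs  ∎
    where
    open ≡-Reasoning

  count-true : ∀ xs → count (λ (_ : A) → true) xs ≡ length xs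
  count-true L.[]       = refl
  count-true (x L.∷ xs) = cong suc (count-true xs)

  count-positive : (P : A → Bool) → ∀ xs → 0 < count P xs → ∃ λ x → P x ≡ true
  count-positive P (x L.∷ xs) 0<c with P x in eq
  ... | true  = x , eq
  ... | false = count-positive P xs 0<c

unique∧set⇒↭ : ∀ {A : Set} {xs ys : List A} → Unique xs → Unique ys →
  (∀ {x} → x ∈ xs → x ∈ ys) → (∀ {x} → x ∈ ys → x ∈ xs) → xs ↭ ys
unique∧set⇒↭ xs! ys! xs⊆ys ys⊆xs = ∼bag⇒↭ (unique∧set⇒bag xs! ys! (mk⇔ xs⊆ys ys⊆xs))

∈-allWords : ∀ {k} (w : Word k) → w ∈ allWords k
∈-allWords []              = here refl
∈-allWords (false ∷ w)     = ∈-++⁺ˡ (∈-map⁺ (false ∷_) (∈-allWords w))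
∈-allWords {suc k} (true ∷ w) = ∈-++⁺ʳ (L.map (false ∷_) (allWords k)) (∈-map⁺ (true ∷_) (∈-allWords w))

unique-allWords : ∀ k → Unique (allWords k)
unique-allWords zero    = [] ∷ []
unique-allWords (suc k) = ++⁺ (map⁺ ∷-injectiveʳ (unique-allWords k)) (map⁺ ∷-injectiveʳ (unique-allWords k)) disjoint
  where
  disjoint : ∀ {w} → w ∈ L.map (false ∷_) (allWords k) × w ∈ L.map (true ∷_) (allWords k) → _
  disjoint (p , q) with _ , _ , refl ← ∈-map⁻ (false ∷_) p | _ , _ , () ← ∈-map⁻ (true ∷_) q

length-allWords : ∀ k → length (allWords k) ≡ 2 ^ k
length-allWords zero    = refl
length-allWords (suc k) = begin
  length (L.map (false ∷_) (allWords k) L.++ L.map (true ∷_) (allWords k))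
    ≡⟨ length-++ (L.map (false ∷_) (allWords k)) ⟩
  length (L.map (false ∷_) (allWords k)) + length (L.map (true ∷_) (allWords k))
    ≡⟨ cong₂ _+_ (length-map _ (allWords k)) (length-map _ (allWords k)) ⟩
  length (allWords k) + length (allWords k)
    ≡⟨ cong (λ l → l + l) (length-allWords k) ⟩
  2 ^ k + 2 ^ k
    ≡⟨ cong (2 ^ k +_) (ℕ.+-identityʳ (2 ^ k)) ⟨
  2 ^ k + (2 ^ k + 0) ∎
  where open ≡-Reasoning

↭-allWords : ∀ {k} {ws : List (Word k)} → Unique ws → (∀ w → w ∈ ws) → ws ↭ allWords k
↭-allWords {k} ws! all = unique∧set⇒↭ ws! (unique-allWords k) (λ _ → ∈-allWords _) (λ _ → all _)

count-translate : ∀ {k} (P : Word k → Bool) z → count (λ w → P (z ⊕ w)) (allWords k) ≡ count P (allWords k)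
count-translate {k} P z = trans (sym (count-map P (z ⊕_) (allWords k))) (count-↭ P translate-↭)
  where
  translate-↭ : L.map (z ⊕_) (allWords k) ↭ allWords k
  translate-↭ = ↭-allWords
    (map⁺ (λ {x} {y} p → trans (sym (⊕-cancelˡ z x)) (trans (cong (z ⊕_) p) (⊕-cancelˡ z y))) (unique-allWords k))
    (λ w → subst (_∈ _) (⊕-cancelˡ z w) (∈-map⁺ (z ⊕_) (∈-allWords (z ⊕ w))))

count-isZero : ∀ k → count isZero (allWords k) ≡ 1
count-isZero zero    = refl
count-isZero (suc k) = begin
  count isZero (L.map (false ∷_) (allWords k) L.++ L.map (true ∷_) (allWords k))
    ≡⟨ count-++ isZero (L.map (false ∷_) (allWords k)) _ ⟩
  count isZero (L.map (false ∷_) (allWords k)) + count isZero (L.map (true ∷_) (allWords k))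
    ≡⟨ cong₂ _+_ (count-map isZero (false ∷_) (allWords k)) (count-map isZero (true ∷_) (allWords k)) ⟩
  count isZero (allWords k) + count (λ _ → false) (allWords k)
    ≡⟨ cong₂ _+_ (count-isZero k) (count-false (allWords k)) ⟩
  1 ∎
  where
  open ≡-Reasoning
  count-false : ∀ {A : Set} (xs : List A) → count (λ _ → false) xs ≡ 0
  count-false L.[]       = refl
  count-false (x L.∷ xs) = count-false xs

-- Syndromes, automorphisms and orbits of cosets.

⊕-commutativeMonoid : ℕ → CommutativeMonoid 0ℓ 0ℓ
⊕-commutativeMonoid k = record
  { Carrier = Word k ; _≈_ = _≡_ ; _∙_ = _⊕_ ; ε = zeros
  ; isCommutativeMonoid = record
    { isMonoid = record
      { isSemigroup = record
        { isMagma = record { isEquivalence = isEquivalence ; ∙-cong = cong₂ _⊕_ }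
        ; assoc = ⊕-assoc }
      ; identity = ⊕-identityˡ , ⊕-identityʳ }
    ; comm = ⊕-comm } }

-- Recursion on the word, in place of the fold over indices inside `kernel`, makes linearity a plain
-- induction.
syndrome : ∀ {n r} → (Fin n → Word r) → Word n → Word r
syndrome H []      = zeros
syndrome H (b ∷ x) = b · H zero ⊕ syndrome (H ∘ suc) x

kernel-syndrome : ∀ {n r} (H : Fin n → Word r) x → kernel H x ≡ isZero (syndrome H x)
kernel-syndrome {n} H x = cong isZero (go x (λ i → i) (λ _ → refl))
  where
  -- The fold reads the full word x at every index, so the induction runs over a suffix y located
  -- inside x by f.
  go : ∀ {k} (y : Word k) (f : Fin k → Fin n) → (∀ i → lookup x (f i) ≡ lookup y i) →
    L.foldr (λ i acc → if lookup x i then H i ⊕ acc else acc) zeros (L.tabulate f) ≡ syndrome (H ∘ f) y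
  go []          f eq = refl
  go (true ∷ y)  f eq rewrite eq zero = cong (H (f zero) ⊕_) (go y (f ∘ suc) (eq ∘ suc))
  go (false ∷ y) f eq rewrite eq zero = trans (go y (f ∘ suc) (eq ∘ suc)) (sym (⊕-identityˡ _))

syndrome-cong : ∀ {n r} {H K : Fin n → Word r} → (∀ i → H i ≡ K i) → ∀ x → syndrome H x ≡ syndrome K x
syndrome-cong H≗K []      = refl
syndrome-cong H≗K (b ∷ x) = cong₂ _⊕_ (cong (b ·_) (H≗K zero)) (syndrome-cong (H≗K ∘ suc) x)

syndrome-⊕ : ∀ {n r} (H : Fin n → Word r) x y → syndrome H (x ⊕ y) ≡ syndrome H x ⊕ syndrome H y
syndrome-⊕ H []      []      = sym (⊕-identityˡ zeros)
syndrome-⊕ H (a ∷ x) (b ∷ y) = begin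
  (a xor b) · H zero ⊕ syndrome (H ∘ suc) (x ⊕ y)
    ≡⟨ cong₂ _⊕_ (·-xor a b (H zero)) (syndrome-⊕ (H ∘ suc) x y) ⟩
  (a · H zero ⊕ b · H zero) ⊕ (syndrome (H ∘ suc) x ⊕ syndrome (H ∘ suc) y)
    ≡⟨ ⊕-interchange (a · H zero) _ _ _ ⟩
  (a · H zero ⊕ syndrome (H ∘ suc) x) ⊕ (b · H zero ⊕ syndrome (H ∘ suc) y) ∎
  where open ≡-Reasoning

syndrome-zeros : ∀ {n r} (H : Fin n → Word r) → syndrome H zeros ≡ zeros
syndrome-zeros {zero}  H = refl
syndrome-zeros {suc n} H = trans (⊕-identityˡ _) (syndrome-zeros (H ∘ suc))

syndrome-flipAt : ∀ {n r} (H : Fin n → Word r) x i → syndrome H (flipAt x i) ≡ syndrome H x ⊕ H i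
syndrome-flipAt H (b ∷ x) zero = begin
  not b · H zero ⊕ s           ≡⟨ cong (_⊕ s) (·-not b) ⟩
  (b · H zero ⊕ H zero) ⊕ s    ≡⟨ ⊕-assoc (b · H zero) _ _ ⟩
  b · H zero ⊕ (H zero ⊕ s)    ≡⟨ cong (b · H zero ⊕_) (⊕-comm (H zero) s) ⟩
  b · H zero ⊕ (s ⊕ H zero)    ≡⟨ ⊕-assoc (b · H zero) _ _ ⟨
  (b · H zero ⊕ s) ⊕ H zero    ∎
  where
  open ≡-Reasoning
  s = syndrome (H ∘ suc) x
  ·-not : ∀ b → not b · H zero ≡ b · H zero ⊕ H zero
  ·-not false = sym (⊕-identityˡ _)
  ·-not true  = sym (⊕-self _)
syndrome-flipAt H (b ∷ x) (suc i) =
  trans (cong (b · H zero ⊕_) (syndrome-flipAt (H ∘ suc) x i)) (sym (⊕-assoc (b · H zero) _ _))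

module _ {r : ℕ} where
  open Sum (⊕-commutativeMonoid r)

  syndrome-sum : ∀ {n} (H : Fin n → Word r) x → syndrome H x ≡ sum (λ i → lookup x i · H i)
  syndrome-sum H []      = refl
  syndrome-sum H (b ∷ x) = cong (b · H zero ⊕_) (syndrome-sum (H ∘ suc) x)

  -- `permute` moves the bit at place i to place π(i), where it meets the column `H` of π(i).
  syndrome-permute : ∀ {n} (H : Fin n → Word r) π x → syndrome H (permute π x) ≡ syndrome (λ i → H (π ⟨$⟩ʳ i)) x
  syndrome-permute H π x = begin
    syndrome H (permute π x)
      ≡⟨ syndrome-sum H (permute π x) ⟩
    sum (λ j → lookup (permute π x) j · H j)
      ≡⟨ sum-cong-≗ (λ j → cong (_· H j) (lookup∘tabulate _ j)) ⟩
    sum (λ j → lookup x (π ⟨$⟩ˡ j) · H j)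
      ≡⟨ sum-permute (λ j → lookup x (π ⟨$⟩ˡ j) · H j) π ⟩
    sum (λ i → lookup x (π ⟨$⟩ˡ (π ⟨$⟩ʳ i)) · H (π ⟨$⟩ʳ i))
      ≡⟨ sum-cong-≗ (λ i → cong (λ j → lookup x j · H (π ⟨$⟩ʳ i)) (inverseˡ π)) ⟩
    sum (λ i → lookup x i · H (π ⟨$⟩ʳ i))
      ≡⟨ syndrome-sum (λ i → H (π ⟨$⟩ʳ i)) x ⟨
    syndrome (λ i → H (π ⟨$⟩ʳ i)) x ∎
    where open ≡-Reasoning

syndrome-map : ∀ {n r s} (H : Fin n → Word r) (f : Word r → Word s) → f zeros ≡ zeros →
  (∀ x y → f (x ⊕ y) ≡ f x ⊕ f y) → ∀ x → syndrome (f ∘ H) x ≡ f (syndrome H x)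
syndrome-map H f f-0 f-⊕ []      = sym f-0
syndrome-map H f f-0 f-⊕ (b ∷ x) = begin
  b · f (H zero) ⊕ syndrome (f ∘ H ∘ suc) x      ≡⟨ cong₂ _⊕_ (f-· b) (syndrome-map (H ∘ suc) f f-0 f-⊕ x) ⟩
  f (b · H zero) ⊕ f (syndrome (H ∘ suc) x)      ≡⟨ f-⊕ _ _ ⟨
  f (b · H zero ⊕ syndrome (H ∘ suc) x)          ∎
  where
  open ≡-Reasoning
  f-· : ∀ b → b · f (H zero) ≡ f (b · H zero)
  f-· false = sym f-0
  f-· true  = refl

wt-permute : ∀ {n} (π : Permutation′ n) x → wt (permute π x) ≡ wt x
wt-permute π x = begin
  wt (permute π x)                            ≡⟨ wt-sum (permute π x) ⟩
  sum (λ j → bit (lookup (permute π x) j))    ≡⟨ sum-cong-≗ (λ j → cong bit (lookup∘tabulate (λ j → lookup x (π ⟨$⟩ˡ j)) j)) ⟩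
  sum (λ j → bit (lookup x (π ⟨$⟩ˡ j)))       ≡⟨ sum-permute (λ i → bit (lookup x i)) (flip π) ⟨
  sum (λ i → bit (lookup x i))                ≡⟨ wt-sum x ⟨
  wt x                                        ∎
  where
  open ≡-Reasoning
  open Sum ℕ.+-0-commutativeMonoid
  wt-sum : ∀ {n} (x : Word n) → wt x ≡ sum (λ i → bit (lookup x i))
  wt-sum []          = refl
  wt-sum (true ∷ x)  = cong suc (wt-sum x)
  wt-sum (false ∷ x) = wt-sum x

permute-⊕ : ∀ {n} (π : Permutation′ n) x y → permute π (x ⊕ y) ≡ permute π x ⊕ permute π y
permute-⊕ π x y = trans (tabulate-cong (λ j → lookup-zipWith _xor_ (π ⟨$⟩ˡ j) x y)) (tabulate-xor _ _)
  where
  tabulate-xor : ∀ {n} (f g : Fin n → Bool) → tabulate (λ j → f j xor g j) ≡ tabulate f ⊕ tabulate g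
  tabulate-xor {zero}  f g = refl
  tabulate-xor {suc n} f g = cong ((f zero xor g zero) ∷_) (tabulate-xor (f ∘ suc) (g ∘ suc))

permute-∘ : ∀ {n} (π ρ : Permutation′ n) x → permute ρ (permute π x) ≡ permute (π ∘ₚ ρ) x
permute-∘ π ρ x = tabulate-cong (λ j → lookup∘tabulate _ (ρ ⟨$⟩ˡ j))

permute-inverse : ∀ {n} (π : Permutation′ n) x → permute π (permute (flip π) x) ≡ x
permute-inverse π x = trans (permute-∘ (flip π) π x)
  (trans (tabulate-cong (λ j → cong (lookup x) (inverseʳ π))) (tabulate∘lookup x))

module _ {n r : ℕ} (H : Fin n → Word r) where

  private
    S : Word n → Word r
    S = syndrome H

  codeword⇒ : ∀ x → kernel H x ≡ true → S x ≡ zeros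
  codeword⇒ x p = isZero⇒≡ (trans (sym (kernel-syndrome H x)) p)

  ⇒codeword : ∀ x → S x ≡ zeros → kernel H x ≡ true
  ⇒codeword x p = trans (kernel-syndrome H x) (≡⇒isZero p)

  coset⇒ : ∀ x y → kernel H (x ⊕ y) ≡ true → S x ≡ S y
  coset⇒ x y p = ⊕-≡zeros (trans (sym (syndrome-⊕ H x y)) (codeword⇒ (x ⊕ y) p))

  ⇒coset : ∀ x y → S x ≡ S y → kernel H (x ⊕ y) ≡ true
  ⇒coset x y p = ⇒codeword (x ⊕ y) (trans (syndrome-⊕ H x y) (trans (cong (_⊕ S y) p) (⊕-self (S y))))

  SameOrbit-sym : ∀ v w → SameOrbit (kernel H) v w → SameOrbit (kernel H) w v
  SameOrbit-sym v w (π , aut , p) = flip π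
    , (λ x → trans (sym (aut (permute (flip π) x))) (cong (kernel H) (permute-inverse π x)))
    , ( begin
        kernel H (permute (flip π) w ⊕ v)              ≡⟨ aut (permute (flip π) w ⊕ v) ⟨
        kernel H (permute π (permute (flip π) w ⊕ v))  ≡⟨ cong (kernel H) (permute-⊕ π (permute (flip π) w) v) ⟩
        kernel H (permute π (permute (flip π) w) ⊕ permute π v)
          ≡⟨ cong (λ z → kernel H (z ⊕ permute π v)) (permute-inverse π w) ⟩
        kernel H (w ⊕ permute π v)                     ≡⟨ cong (kernel H) (⊕-comm w (permute π v)) ⟩
        kernel H (permute π v ⊕ w)                     ≡⟨ p ⟩
        true                                           ∎ )
    where open ≡-Reasoning

  SameOrbit-trans : ∀ u v w → SameOrbit (kernel H) u v → SameOrbit (kernel H) v w → SameOrbit (kernel H) u w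
  SameOrbit-trans u v w (π , πaut , p) (ρ , ρaut , q) = π ∘ₚ ρ
    , (λ x → trans (cong (kernel H) (sym (permute-∘ π ρ x))) (trans (ρaut (permute π x)) (πaut x)))
    , ⇒coset (permute (π ∘ₚ ρ) u) w (begin
        S (permute (π ∘ₚ ρ) u)        ≡⟨ cong S (permute-∘ π ρ u) ⟨
        S (permute ρ (permute π u))   ≡⟨ coset⇒ (permute ρ (permute π u)) (permute ρ v)
            (trans (cong (kernel H) (sym (permute-⊕ ρ (permute π u) v))) (trans (ρaut (permute π u ⊕ v)) p)) ⟩
        S (permute ρ v)               ≡⟨ coset⇒ (permute ρ v) w q ⟩
        S w                           ∎)
    where open ≡-Reasoning

  SameOrbit-coset : ∀ v w → S v ≡ S w → SameOrbit (kernel H) v w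
  SameOrbit-coset v w p = idₚ , (λ x → cong (kernel H) (tabulate∘lookup x))
    , ⇒coset (permute idₚ v) w (trans (cong S (tabulate∘lookup v)) p)

  -- A permutation of columns induced by an invertible linear map f of syndromes preserves the zero
  -- syndrome, hence the code, and carries the coset with syndrome s to the one with syndrome f s.
  -- Taking f to be an involution supplies its inverse.
  SameOrbit-linear : (π : Permutation′ n) (f : Word r → Word r) → (∀ x y → f (x ⊕ y) ≡ f x ⊕ f y) →
    (∀ x → f (f x) ≡ x) → (∀ i → H (π ⟨$⟩ʳ i) ≡ f (H i)) → ∀ v w → S w ≡ f (S v) → SameOrbit (kernel H) v w
  SameOrbit-linear π f f-⊕ f-f Hπ v w p = π , aut , ⇒coset (permute π v) w (trans (S-permute v) (sym p))
    where
    f-0 : f zeros ≡ zeros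
    f-0 = trans (cong f (sym (⊕-self zeros))) (trans (f-⊕ zeros zeros) (⊕-self (f zeros)))
    S-permute : ∀ x → S (permute π x) ≡ f (S x)
    S-permute x = trans (syndrome-permute H π x) (trans (syndrome-cong Hπ x) (syndrome-map H f f-0 f-⊕ x))
    isZero-f : ∀ s → isZero (f s) ≡ isZero s
    isZero-f s with isZero s in eq
    ... | true  = ≡⇒isZero (trans (cong f (isZero⇒≡ eq)) f-0)
    ... | false = ≢⇒isZero (λ fs≡0 → isZero⇒≢ eq (trans (sym (f-f s)) (trans (cong f fs≡0) f-0)))
    aut : ∀ x → kernel H (permute π x) ≡ kernel H x
    aut x = begin
      kernel H (permute π x)    ≡⟨ kernel-syndrome H (permute π x) ⟩
      isZero (S (permute π x))  ≡⟨ cong isZero (S-permute x) ⟩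
      isZero (f (S x))          ≡⟨ isZero-f (S x) ⟩
      isZero (S x)              ≡⟨ kernel-syndrome H x ⟨
      kernel H x                ∎
      where open ≡-Reasoning

-- Distance to the code as a function of the syndrome.

syndrome-lipschitz : ∀ {n r} (H : Fin n → Word r) (δ : Word r → ℕ) → (∀ s i → δ (s ⊕ H i) ≤ suc (δ s)) →
  ∀ x s → δ (s ⊕ syndrome H x) ≤ wt x + δ s
syndrome-lipschitz H δ lip [] s = ℕ.≤-reflexive (cong δ (⊕-identityʳ s))
syndrome-lipschitz H δ lip (false ∷ x) s =
  subst (λ t → δ (s ⊕ t) ≤ wt x + δ s) (sym (⊕-identityˡ _)) (syndrome-lipschitz (H ∘ suc) δ (λ s → lip s ∘ suc) x s)
syndrome-lipschitz H δ lip (true ∷ x) s = begin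
  δ (s ⊕ (H zero ⊕ syndrome (H ∘ suc) x))  ≡⟨ cong δ (⊕-assoc s _ _) ⟨
  δ ((s ⊕ H zero) ⊕ syndrome (H ∘ suc) x)  ≤⟨ syndrome-lipschitz (H ∘ suc) δ (λ s → lip s ∘ suc) x _ ⟩
  wt x + δ (s ⊕ H zero)                    ≤⟨ ℕ.+-monoʳ-≤ (wt x) (lip s zero) ⟩
  wt x + suc (δ s)                         ≡⟨ ℕ.+-suc (wt x) (δ s) ⟩
  suc (wt x + δ s)                         ∎
  where open ℕ.≤-Reasoning

wt-flipAt-≤ : ∀ {n} (x : Word n) i → wt (flipAt x i) ≤ suc (wt x)
wt-flipAt-≤ (false ∷ x) zero    = ℕ.≤-refl
wt-flipAt-≤ (true ∷ x)  zero    = ℕ.m≤n⇒m≤1+n (ℕ.n≤1+n (wt x))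
wt-flipAt-≤ (false ∷ x) (suc i) = wt-flipAt-≤ x i
wt-flipAt-≤ (true ∷ x)  (suc i) = s≤s (wt-flipAt-≤ x i)

wt-zeros : ∀ n → wt (zeros {n}) ≡ 0
wt-zeros zero    = refl
wt-zeros (suc n) = wt-zeros n

wt-≤ : ∀ {n} (x : Word n) → wt x ≤ n
wt-≤ []          = z≤n
wt-≤ (true ∷ x)  = s≤s (wt-≤ x)
wt-≤ (false ∷ x) = ℕ.m≤n⇒m≤1+n (wt-≤ x)

module _ {A : Set} (f : A → ℕ) where

  foldr-⊓-≤ : ∀ {x xs n} → x ∈ xs → L.foldr _⊓_ n (L.map f xs) ≤ f x
  foldr-⊓-≤ (here refl) = ℕ.m⊓n≤m (f _) _
  foldr-⊓-≤ (there p)   = ℕ.≤-trans (ℕ.m⊓n≤n (f _) _) (foldr-⊓-≤ p)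

  foldr-⊓-≥ : ∀ {d n} → d ≤ n → (∀ x → d ≤ f x) → ∀ xs → d ≤ L.foldr _⊓_ n (L.map f xs)
  foldr-⊓-≥ d≤n d≤f L.[]       = d≤n
  foldr-⊓-≥ d≤n d≤f (x L.∷ xs) = ℕ.⊓-glb (d≤f x) (foldr-⊓-≥ d≤n d≤f xs)

  foldr-⊔-≥ : ∀ {x xs} → x ∈ xs → f x ≤ L.foldr _⊔_ 0 (L.map f xs)
  foldr-⊔-≥ (here refl) = ℕ.m≤m⊔n (f _) _
  foldr-⊔-≥ (there p)   = ℕ.≤-trans (foldr-⊔-≥ p) (ℕ.m≤n⊔m (f _) _)

  foldr-⊔-≤ : ∀ {d} → (∀ x → f x ≤ d) → ∀ xs → L.foldr _⊔_ 0 (L.map f xs) ≤ d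
  foldr-⊔-≤ f≤d L.[]       = z≤n
  foldr-⊔-≤ f≤d (x L.∷ xs) = ℕ.⊔-lub (f≤d x) (foldr-⊔-≤ f≤d xs)

-- The coset leader weight is the unique 1-Lipschitz function of the syndrome that vanishes only at 0
-- and can be decreased by adding a suitable column wherever it is positive.
module CosetWeight {n r : ℕ} (H : Fin n → Word r) (δ : Word r → ℕ)
  (δ-zeros : δ zeros ≡ 0) (δ≡0 : ∀ s → δ s ≡ 0 → s ≡ zeros)
  (lipschitz : ∀ s i → δ (s ⊕ H i) ≤ suc (δ s))
  (descent : ∀ s k → δ s ≡ suc k → ∃ λ i → δ (s ⊕ H i) ≡ k) where

  private
    C : Code n
    C = kernel H
    S : Word n → Word r
    S = syndrome H

  δ≤wt : ∀ x → δ (S x) ≤ wt x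
  δ≤wt x = begin
    δ (S x)           ≡⟨ cong δ (⊕-identityˡ (S x)) ⟨
    δ (zeros ⊕ S x)   ≤⟨ syndrome-lipschitz H δ lipschitz x zeros ⟩
    wt x + δ zeros    ≡⟨ cong (wt x +_) δ-zeros ⟩
    wt x + 0          ≡⟨ ℕ.+-identityʳ (wt x) ⟩
    wt x              ∎
    where open ℕ.≤-Reasoning

  -- Descent spends one coordinate flip per unit of δ; when δ reaches 0 the remaining syndrome is 0
  -- and the zero word finishes.
  leader : ∀ s → ∃ λ e → S e ≡ s × wt e ≤ δ s
  leader s = go (δ s) s refl
    where
    go : ∀ k s → δ s ≡ k → ∃ λ e → S e ≡ s × wt e ≤ k
    go zero s p = zeros , trans (syndrome-zeros H) (sym (δ≡0 s p)) , ℕ.≤-reflexive (wt-zeros n)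
    go (suc k) s p with i , q ← descent s k p with e , Se , wt-e ← go k (s ⊕ H i) q =
      flipAt e i
      , trans (syndrome-flipAt H e i) (trans (cong (_⊕ H i) Se) (⊕-cancelʳ s (H i)))
      , ℕ.≤-trans (wt-flipAt-≤ e i) (s≤s wt-e)

  dist-δ : ∀ x → dist C x ≡ δ (S x)
  dist-δ x = ℕ.≤-antisym upper (foldr-⊓-≥ d (ℕ.≤-trans (δ≤wt x) (wt-≤ x)) lower (allWords n))
    where
    d : Word n → ℕ
    d y = if C y then ham x y else n
    lower : ∀ y → δ (S x) ≤ d y
    lower y with C y in Cy
    -- A non-codeword contributes the default value n of `dist`, which is never below δ because δ is
    -- bounded by a weight.
    ... | false = ℕ.≤-trans (δ≤wt x) (wt-≤ x)
    ... | true  = subst (λ s → δ s ≤ ham x y)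
      (trans (syndrome-⊕ H x y) (trans (cong (S x ⊕_) (codeword⇒ H y Cy)) (⊕-identityʳ (S x)))) (δ≤wt (x ⊕ y))
    upper : dist C x ≤ δ (S x)
    upper with e , Se , wt-e ← leader (S x) = begin
      dist C x        ≤⟨ foldr-⊓-≤ d (∈-allWords (x ⊕ e)) ⟩
      d (x ⊕ e)       ≡⟨ cong (λ b → if b then ham x (x ⊕ e) else n) (⇒coset H x e (sym Se)) ⟩
      ham x (x ⊕ e)   ≡⟨ cong wt (⊕-cancelˡ x e) ⟩
      wt e            ≤⟨ wt-e ⟩
      δ (S x)         ∎
      where open ℕ.≤-Reasoning

  coveringRadius-δ : ∀ {ρ} → (∀ s → δ s ≤ ρ) → ∀ s → δ s ≡ ρ → coveringRadius C ≡ ρ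
  coveringRadius-δ δ≤ρ s δs≡ρ with e , Se , _ ← leader s = ℕ.≤-antisym
    (foldr-⊔-≤ (dist C) (λ x → ℕ.≤-trans (ℕ.≤-reflexive (dist-δ x)) (δ≤ρ (S x))) (allWords n))
    (ℕ.≤-trans (ℕ.≤-reflexive (trans (sym δs≡ρ) (trans (cong δ (sym Se)) (sym (dist-δ e)))))
               (foldr-⊔-≥ (dist C) (∈-allWords e)))

  nbrsIn-δ : ∀ x l → nbrsIn C x l ≡ count (λ i → δ (S x ⊕ H i) ≡ᵇ l) (allFin n)
  nbrsIn-δ x l = trans (length-filterᵇ _ (allFin n))
    (count-cong (λ i → cong (_≡ᵇ l) (trans (dist-δ (flipAt x i)) (cong δ (syndrome-flipAt H x i)))) (allFin n))

  -- Permutations keep weights, so the image of a leader of the coset of v is an equally light word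
  -- in the coset of w; symmetry of the orbit relation gives the other inequality.
  SameOrbit-δ : ∀ v w → SameOrbit C v w → δ (S v) ≡ δ (S w)
  SameOrbit-δ v w o = ℕ.≤-antisym (δ-≤ w v (SameOrbit-sym H v w o)) (δ-≤ v w o)
    where
    δ-≤ : ∀ v w → SameOrbit C v w → δ (S w) ≤ δ (S v)
    δ-≤ v w (π , aut , p) with e , Se , wt-e ← leader (S v) = begin
      δ (S w)              ≡⟨ cong δ (coset⇒ H (permute π v) w p) ⟨
      δ (S (permute π v))  ≡⟨ cong δ (coset⇒ H (permute π e) (permute π v) (trans (cong C (sym (permute-⊕ π e v))) (trans (aut (e ⊕ v)) (⇒coset H e v Se)))) ⟨
      δ (S (permute π e))  ≤⟨ δ≤wt (permute π e) ⟩
      wt (permute π e)     ≡⟨ wt-permute π e ⟩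
      wt e                 ≤⟨ wt-e ⟩
      δ (S v)              ∎
      where open ℕ.≤-Reasoning

-- The number of codewords.

length-cartesianProductWith : ∀ {A B C : Set} (f : A → B → C) xs ys →
  length (L.cartesianProductWith f xs ys) ≡ length xs * length ys
length-cartesianProductWith f L.[]       ys = refl
length-cartesianProductWith f (x L.∷ xs) ys =
  trans (length-++ (L.map (f x) ys)) (cong₂ _+_ (length-map (f x) ys) (length-cartesianProductWith f xs ys))

-- Every word is, in exactly one way, a codeword plus the chosen representative of its coset. Stated
-- as a product to avoid subtracting exponents.
size-kernel : ∀ {n r} (H : Fin n → Word r) → (∀ s → ∃ λ e → syndrome H e ≡ s) → size (kernel H) * 2 ^ r ≡ 2 ^ n
size-kernel {n} {r} H section = begin
  length codewords * 2 ^ r                ≡⟨ cong (length codewords *_) (length-allWords r) ⟨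
  length codewords * length (allWords r)  ≡⟨ length-cartesianProductWith translate codewords (allWords r) ⟨
  length pairs                            ≡⟨ ↭-length (unique∧set⇒↭ pairs! words! pairs⊆words words⊆pairs) ⟩
  length words                            ≡⟨ length-map (_, zeros) (allWords n) ⟩
  length (allWords n)                     ≡⟨ length-allWords n ⟩
  2 ^ n                                   ∎
  where
  open ≡-Reasoning
  S : Word n → Word r
  S = syndrome H
  e : Word r → Word n
  e s = proj₁ (section s)
  codewords : List (Word n)
  codewords = filterᵇ (kernel H) (allWords n)
  -- Recording the syndrome of x, which is 0 on codewords, makes the map injective on all pairs.
  translate : Word n → Word r → Word n × Word r
  translate x s = x ⊕ e s , S x
  pairs words : List (Word n × Word r)
  pairs = L.cartesianProductWith translate codewords (allWords r)
  words = L.map (_, zeros) (allWords n)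
  S-translate : ∀ x s → S (x ⊕ e s) ≡ S x ⊕ s
  S-translate x s = trans (syndrome-⊕ H x (e s)) (cong (S x ⊕_) (proj₂ (section s)))
  translate-injective : ∀ {x y s t} → translate x s ≡ translate y t → x ≡ y × s ≡ t
  translate-injective {x} {y} {s} {t} p =
    trans (sym (⊕-cancelʳ x (e s)))
      (trans (cong₂ _⊕_ (cong proj₁ p) (cong e s≡t)) (⊕-cancelʳ y (e t))) , s≡t
    where
    s≡t : s ≡ t
    s≡t = begin
      s                 ≡⟨ ⊕-cancelˡ (S x) s ⟨
      S x ⊕ (S x ⊕ s)   ≡⟨ cong (S x ⊕_) (S-translate x s) ⟨
      S x ⊕ S (x ⊕ e s) ≡⟨ cong₂ (λ a b → a ⊕ S b) (cong proj₂ p) (cong proj₁ p) ⟩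
      S y ⊕ S (y ⊕ e t) ≡⟨ cong (S y ⊕_) (S-translate y t) ⟩
      S y ⊕ (S y ⊕ t)   ≡⟨ ⊕-cancelˡ (S y) t ⟩
      t                 ∎
  pairs! : Unique pairs
  pairs! = cartesianProductWith⁺ translate translate-injective
    (filter⁺ (T? ∘ kernel H) (unique-allWords n)) (unique-allWords r)
  words! : Unique words
  words! = map⁺ (cong proj₁) (unique-allWords n)
  pairs⊆words : ∀ {p} → p ∈ pairs → p ∈ words
  pairs⊆words p∈ with x , s , x∈ , _ , refl ← ∈-cartesianProductWith⁻ translate codewords (allWords r) p∈ =
    subst (λ t → (x ⊕ e s , t) ∈ words)
      (sym (codeword⇒ H x (Equivalence.to T-≡ (proj₂ (∈-filter⁻ (T? ∘ kernel H) {xs = allWords n} x∈)))))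
      (∈-map⁺ (_, zeros) (∈-allWords (x ⊕ e s)))
  words⊆pairs : ∀ {p} → p ∈ words → p ∈ pairs
  words⊆pairs p∈ with w , _ , refl ← ∈-map⁻ (_, zeros) p∈ =
    subst (_∈ pairs) (cong₂ _,_ (⊕-cancelʳ w (e (S w))) Sx≡0)
      (∈-cartesianProductWith⁺ translate
        (∈-filter⁺ (T? ∘ kernel H) (∈-allWords x) (Equivalence.from T-≡ (⇒codeword H x Sx≡0)))
        (∈-allWords (S w)))
    where
    x : Word n
    x = w ⊕ e (S w)
    Sx≡0 : S x ≡ zeros
    Sx≡0 = trans (S-translate w (S w)) (⊕-self (S w))

-- The powers of α enumerate the nonzero vectors.

_≟_ : ∀ {k} (x y : Word k) → Dec (x ≡ y)
_≟_ = ≡-dec Bool._≟_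

toFin : ∀ {k} → Word k → Fin (2 ^ k)
toFin w = Fin.funToFin (λ i → if lookup w i then suc zero else zero)

toFin-injective : ∀ {k} {x y : Word k} → toFin x ≡ toFin y → x ≡ y
toFin-injective {k} {x} {y} p = begin
  x                          ≡⟨ tabulate∘lookup x ⟨
  tabulate (lookup x)  ≡⟨ tabulate-cong (λ i → digit-injective (lookup-eq i)) ⟩
  tabulate (lookup y)  ≡⟨ tabulate∘lookup y ⟩
  y                          ∎
  where
  open ≡-Reasoning
  digit : Bool → Fin 2
  digit b = if b then suc zero else zero
  digit-injective : ∀ {a b} → digit a ≡ digit b → a ≡ b
  digit-injective {false} {false} _ = refl
  digit-injective {true}  {true}  _ = refl
  lookup-eq : ∀ i → digit (lookup x i) ≡ digit (lookup y i)
  lookup-eq i = begin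
    digit (lookup x i)           ≡⟨ finToFun-funToFin (digit ∘ lookup x) i ⟨
    Fin.finToFun (toFin x) i     ≡⟨ cong (λ z → Fin.finToFun z i) p ⟩
    Fin.finToFun (toFin y) i     ≡⟨ finToFun-funToFin (digit ∘ lookup y) i ⟩
    digit (lookup y i)           ∎

-- Pigeonhole: 0, a missed nonzero w and the n columns would be n + 2 distinct words among at most n
-- + 1.
injective⇒surjective : ∀ {n m} (h : Fin n → Word m) → (∀ i → h i ≢ zeros) → (∀ {i j} → h i ≡ h j → i ≡ j) →
  2 ^ m ≤ suc n → ∀ w → w ≢ zeros → ∃ λ i → h i ≡ w
injective⇒surjective {n} {m} h h≢0 h-inj 2^m≤ w w≢0 with any? (λ i → h i ≟ w)
... | yes p = p
... | no ¬p = contradiction (ℕ.≤-trans (injective⇒≤ (λ {i} {j} → g-inj i j ∘ toFin-injective)) 2^m≤) ℕ.1+n≰n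
  where
  g : Fin (2 + n) → Word m
  g zero          = zeros
  g (suc zero)    = w
  g (suc (suc i)) = h i
  g-inj : ∀ i j → g i ≡ g j → i ≡ j
  g-inj zero          zero          _ = refl
  g-inj zero          (suc zero)    p = contradiction (sym p) w≢0
  g-inj zero          (suc (suc j)) p = contradiction (sym p) (h≢0 j)
  g-inj (suc zero)    zero          p = contradiction p w≢0
  g-inj (suc zero)    (suc zero)    _ = refl
  g-inj (suc zero)    (suc (suc j)) p = contradiction (j , sym p) ¬p
  g-inj (suc (suc i)) zero          p = contradiction p (h≢0 i)
  g-inj (suc (suc i)) (suc zero)    p = contradiction (i , p) ¬p
  g-inj (suc (suc i)) (suc (suc j)) p = cong (λ k → Fin.suc (Fin.suc k)) (h-inj p)

shiftIn-⊕ : ∀ {k} a b (x y : Word k) → shiftIn (a xor b) (x ⊕ y) ≡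
  (proj₁ (shiftIn a x) ⊕ proj₁ (shiftIn b y) , proj₂ (shiftIn a x) xor proj₂ (shiftIn b y))
shiftIn-⊕ a b []       []       = refl
shiftIn-⊕ a b (x ∷ xs) (y ∷ ys) rewrite shiftIn-⊕ x y xs ys with shiftIn x xs | shiftIn y ys
... | _ , _ | _ , _ = refl

mulα-shiftIn : ∀ {m} (c v : Word m) → mulα c v ≡ proj₁ (shiftIn false v) ⊕ proj₂ (shiftIn false v) · c
mulα-shiftIn c v with shiftIn false v
... | ys , true  = refl
... | ys , false = sym (⊕-identityʳ ys)

mulα-⊕ : ∀ {m} (c v w : Word m) → mulα c (v ⊕ w) ≡ mulα c v ⊕ mulα c w
mulα-⊕ c v w rewrite mulα-shiftIn c (v ⊕ w) | mulα-shiftIn c v | mulα-shiftIn c w | shiftIn-⊕ false false v w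
  with shiftIn false v | shiftIn false w
... | xs , a | ys , b = trans (cong ((xs ⊕ ys) ⊕_) (·-xor a b c)) (⊕-interchange xs ys (a · c) (b · c))

mulα-zeros : ∀ {m} (c : Word m) → mulα c zeros ≡ zeros
mulα-zeros c = trans (cong (mulα c) (sym (⊕-self zeros))) (trans (mulα-⊕ c zeros zeros) (⊕-self (mulα c zeros)))

powα-+ : ∀ {m} (c : Word m) k {i j} → powα c i ≡ powα c j → powα c (k + i) ≡ powα c (k + j)
powα-+ c zero    p = p
powα-+ c (suc k) p = cong (mulα c) (powα-+ c k p)

powα-zeros : ∀ {m} (c : Word m) k {i} → powα c i ≡ zeros → powα c (k + i) ≡ zeros
powα-zeros c zero    p = p
powα-zeros c (suc k) p = trans (cong (mulα c) (powα-zeros c k p)) (mulα-zeros c)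

oneF≢zeros : ∀ {m} → 1 ≤ m → oneF {m} ≢ zeros
oneF≢zeros (s≤s _) ()

module _ {m} (1≤m : 1 ≤ m) (c : Word m) (α-primitive : IsPrimitive c) where

  private
    N : ℕ
    N = 2 ^ m ∸ 1

  -- Once a power of α is zero, all later powers are, including α^N = 1.
  hcol≢zeros : ∀ i → hcol c i ≢ zeros
  hcol≢zeros i p = oneF≢zeros 1≤m (trans (sym (proj₁ α-primitive))
    (trans (cong (powα c) (sym (ℕ.m∸n+n≡m (ℕ.<⇒≤ (toℕ<n i))))) (powα-zeros c (N ∸ toℕ i) p)))

  -- Multiplying α^i = α^j by α^(N - j) gives α^(N - j + i) = 1 with 0 < N - j + i < N.
  powα-distinct : ∀ {i j} → i < j → j < N → powα c i ≢ powα c j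
  powα-distinct {i} {j} i<j j<N p = proj₂ α-primitive (N ∸ j + i)
    (ℕ.<-≤-trans (ℕ.m<n⇒0<n∸m j<N) (ℕ.m≤m+n (N ∸ j) i))
    (ℕ.<-≤-trans (ℕ.+-monoʳ-< (N ∸ j) i<j) (ℕ.≤-reflexive N∸j+j≡N))
    (trans (powα-+ c (N ∸ j) p) (trans (cong (powα c) N∸j+j≡N) (proj₁ α-primitive)))
    where
    N∸j+j≡N : N ∸ j + j ≡ N
    N∸j+j≡N = ℕ.m∸n+n≡m (ℕ.<⇒≤ j<N)

  hcol-injective : ∀ {i j} → hcol c i ≡ hcol c j → i ≡ j
  hcol-injective {i} {j} p with ℕ.<-cmp (toℕ i) (toℕ j)
  ... | tri< i<j _ _ = contradiction p (powα-distinct i<j (toℕ<n j))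
  ... | tri≈ _ i≡j _ = toℕ-injective i≡j
  ... | tri> _ _ j<i = contradiction (sym p) (powα-distinct j<i (toℕ<n i))

  hcol-surjective : ∀ w → w ≢ zeros → ∃ λ i → hcol c i ≡ w
  hcol-surjective = injective⇒surjective (hcol c) hcol≢zeros hcol-injective
    (ℕ.≤-reflexive (sym (ℕ.m+[n∸m]≡n {1} (ℕ.m^n>0 2 m))))

-- Sums over all words, and the syndrome of the all-one word.

xorSum : ∀ {A : Set} → (A → Bool) → List A → Bool
xorSum f = L.foldr (λ x acc → f x xor acc) false

xorSum-++ : ∀ {A : Set} (f : A → Bool) xs ys → xorSum f (xs L.++ ys) ≡ xorSum f xs xor xorSum f ys
xorSum-++ f L.[]       ys = refl
xorSum-++ f (x L.∷ xs) ys = trans (cong (f x xor_) (xorSum-++ f xs ys)) (sym (xor-assoc (f x) _ _))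

xorSum-map : ∀ {A B : Set} (f : B → Bool) (g : A → B) xs → xorSum f (L.map g xs) ≡ xorSum (f ∘ g) xs
xorSum-map f g L.[]       = refl
xorSum-map f g (x L.∷ xs) = cong (f (g x) xor_) (xorSum-map f g xs)

xorSum-xor : ∀ {A : Set} (f g : A → Bool) xs → xorSum (λ x → f x xor g x) xs ≡ xorSum f xs xor xorSum g xs
xorSum-xor f g L.[]       = refl
xorSum-xor f g (x L.∷ xs) rewrite xorSum-xor f g xs =
  solve 4 (λ a b c d → (a :+ b) :+ (c :+ d) := (a :+ c) :+ (b :+ d)) refl (f x) (g x) (xorSum f xs) (xorSum g xs)

xorSum-∧ : ∀ {A : Set} b (f : A → Bool) xs → xorSum (λ x → b ∧ f x) xs ≡ b ∧ xorSum f xs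
xorSum-∧ true  f xs         = refl
xorSum-∧ false f L.[]       = refl
xorSum-∧ false f (x L.∷ xs) = xorSum-∧ false f xs

-- For `e₁` and `e₂` the half with first bit 1 repeats the other half plus a polynomial of lower
-- degree; the repeated parts cancel, which drives the degree down.
xorSum-split : ∀ {k} (f : Word (suc k) → Bool) →
  xorSum f (allWords (suc k)) ≡ xorSum (f ∘ (false ∷_)) (allWords k) xor xorSum (f ∘ (true ∷_)) (allWords k)
xorSum-split {k} f = trans (xorSum-++ f (L.map (false ∷_) (allWords k)) _)
  (cong₂ _xor_ (xorSum-map f (false ∷_) (allWords k)) (xorSum-map f (true ∷_) (allWords k)))

xor-cancel : ∀ a b → a xor (b xor a) ≡ b
xor-cancel a b = solve 2 (λ a b → a :+ (b :+ a) := b) refl a b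

xorSum-const : ∀ k b → xorSum (λ _ → b) (allWords (suc k)) ≡ false
xorSum-const k b = trans (xorSum-split {k} (λ _ → b)) (xor-same (xorSum (λ _ → b) (allWords k)))

-- Over 𝔽₂ a polynomial of degree less than k sums to 0 over all of 𝔽₂ᵏ.
xorSum-e₁ : ∀ k → xorSum e₁ (allWords (2 + k)) ≡ false
xorSum-e₁ k = begin
  xorSum e₁ (allWords (2 + k))          ≡⟨ xorSum-split {suc k} e₁ ⟩
  E xor xorSum (λ x → true xor e₁ x) W  ≡⟨ cong (E xor_) (xorSum-xor (λ _ → true) e₁ W) ⟩
  E xor (xorSum (λ _ → true) W xor E)   ≡⟨ xor-cancel E _ ⟩
  xorSum (λ _ → true) W                 ≡⟨ xorSum-const k true ⟩
  false                                 ∎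
  where
  open ≡-Reasoning
  W = allWords (suc k)
  E = xorSum e₁ W

xorSum-e₂ : ∀ k → xorSum e₂ (allWords (3 + k)) ≡ false
xorSum-e₂ k = begin
  xorSum e₂ (allWords (3 + k))          ≡⟨ xorSum-split {2 + k} e₂ ⟩
  E xor xorSum (λ x → e₁ x xor e₂ x) W  ≡⟨ cong (E xor_) (xorSum-xor e₁ e₂ W) ⟩
  E xor (xorSum e₁ W xor E)             ≡⟨ xor-cancel E _ ⟩
  xorSum e₁ W                           ≡⟨ xorSum-e₁ k ⟩
  false                                 ∎
  where
  open ≡-Reasoning
  W = allWords (2 + k)
  E = xorSum e₂ W

wordSum : ∀ {k} → List (Word k) → Word k
wordSum = L.foldr _⊕_ zeros

wordSum-↭ : ∀ {k} {xs ys : List (Word k)} → xs ↭ ys → wordSum xs ≡ wordSum ys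
wordSum-↭ Perm.refl = refl
wordSum-↭ (Perm.prep x p) = cong (x ⊕_) (wordSum-↭ p)
wordSum-↭ (Perm.swap {xs} {ys} x y p) = begin
  x ⊕ (y ⊕ wordSum xs)  ≡⟨ ⊕-assoc x y _ ⟨
  (x ⊕ y) ⊕ wordSum xs  ≡⟨ cong₂ _⊕_ (⊕-comm x y) (wordSum-↭ p) ⟩
  (y ⊕ x) ⊕ wordSum ys  ≡⟨ ⊕-assoc y x _ ⟩
  y ⊕ (x ⊕ wordSum ys)  ∎
  where open ≡-Reasoning
wordSum-↭ (Perm.trans p q) = trans (wordSum-↭ p) (wordSum-↭ q)

wordSum-++ : ∀ {k} (xs ys : List (Word k)) → wordSum (xs L.++ ys) ≡ wordSum xs ⊕ wordSum ys
wordSum-++ L.[]       ys = sym (⊕-identityˡ _)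
wordSum-++ (x L.∷ xs) ys = trans (cong (x ⊕_) (wordSum-++ xs ys)) (sym (⊕-assoc x _ _))

wordSum-∷ : ∀ {k} (f : Word k → Bool) xs → wordSum (L.map (λ x → f x ∷ x) xs) ≡ xorSum f xs ∷ wordSum xs
wordSum-∷ f L.[]       = refl
wordSum-∷ f (x L.∷ xs) = cong ((f x ∷ x) ⊕_) (wordSum-∷ f xs)

wordSum-allWords : ∀ k → wordSum (allWords (2 + k)) ≡ zeros
wordSum-allWords k = begin
  wordSum (L.map (false ∷_) W L.++ L.map (true ∷_) W)
    ≡⟨ wordSum-++ (L.map (false ∷_) W) _ ⟩
  wordSum (L.map (false ∷_) W) ⊕ wordSum (L.map (true ∷_) W)
    ≡⟨ cong₂ _⊕_ (wordSum-∷ (λ _ → false) W) (wordSum-∷ (λ _ → true) W) ⟩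
  (xorSum (λ _ → false) W xor xorSum (λ _ → true) W) ∷ (wordSum W ⊕ wordSum W)
    ≡⟨ cong₂ _∷_ (cong₂ _xor_ (xorSum-const k false) (xorSum-const k true)) (⊕-self (wordSum W)) ⟩
  zeros ∎
  where
  open ≡-Reasoning
  W = allWords (suc k)

syndrome-ones : ∀ {n r} (H : Fin n → Word r) → syndrome H ones ≡ wordSum (L.map H (allFin n))
syndrome-ones {n} H = trans (go H id) (cong wordSum (sym (map-tabulate id H)))
  where
  go : ∀ {k r n} (H : Fin n → Word r) (f : Fin k → Fin n) → syndrome (H ∘ f) ones ≡ wordSum (L.tabulate (H ∘ f))
  go {zero}  H f = refl
  go {suc k} H f = cong (H (f zero) ⊕_) (go H (f ∘ suc))

-- Translation by a z with `polar x z` equal to 1 exchanges the two level sets of `polar x`, so each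
-- is half of the space.
count-polar : ∀ {m} → m % 2 ≡ 0 → (x : Word m) → x ≢ zeros →
  count (polar x) (allWords m) ≡ count (not ∘ polar x) (allWords m)
  × count (polar x) (allWords m) * 2 ≡ 2 ^ m
count-polar {m} even x x≢0 with z , xz ← polar-nondegenerate even x x≢0 = half , (begin
  K * 2                                     ≡⟨ ℕ.*-comm K 2 ⟩
  K + (K + 0)                               ≡⟨ cong (K +_) (trans (ℕ.+-identityʳ K) half) ⟩
  K + count (not ∘ polar x) (allWords m)    ≡⟨ count-disjoint (polar x) (not ∘ polar x) (λ _ → true) (λ w → complement (polar x w)) (allWords m) ⟩
  count (λ _ → true) (allWords m)           ≡⟨ count-true (allWords m) ⟩
  length (allWords m)                       ≡⟨ length-allWords m ⟩
  2 ^ m                                     ∎)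
  where
  open ≡-Reasoning
  K = count (polar x) (allWords m)
  complement : ∀ b → bit b + bit (not b) ≡ 1
  complement true  = refl
  complement false = refl
  half : K ≡ count (not ∘ polar x) (allWords m)
  half = trans (sym (count-translate (polar x) z))
    (count-cong (λ w → trans (polar-⊕ʳ x z w) (cong (_xor polar x w) xz)) (allWords m))

-- v a b c runs over the rows v_{i₁,i₂}, each of which is a polynomial in the two low digits of the weight.
v : Bool → Bool → Bool → ∀ {k} → Word k → Bool
v a b c x = a xor ((b ∧ e₁ x) xor (c ∧ e₂ x))

xorSum-v : ∀ {k} a b c (xs : List (Word k)) → xorSum (λ _ → a) xs ≡ false → xorSum e₁ xs ≡ false →
  xorSum e₂ xs ≡ false → xorSum (v a b c) xs ≡ false
xorSum-v a b c xs Σa Σe₁ Σe₂ = begin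
  xorSum (v a b c) xs
    ≡⟨ xorSum-xor (λ _ → a) _ xs ⟩
  xorSum (λ _ → a) xs xor xorSum (λ x → (b ∧ e₁ x) xor (c ∧ e₂ x)) xs
    ≡⟨ cong₂ _xor_ Σa (xorSum-xor (λ x → b ∧ e₁ x) _ xs) ⟩
  xorSum (λ x → b ∧ e₁ x) xs xor xorSum (λ x → c ∧ e₂ x) xs
    ≡⟨ cong₂ _xor_ (trans (xorSum-∧ b e₁ xs) (cong (b ∧_) Σe₁)) (trans (xorSum-∧ c e₂ xs) (cong (c ∧_) Σe₂)) ⟩
  (b ∧ false) xor (c ∧ false)
    ≡⟨ cong₂ _xor_ (∧-zeroʳ b) (∧-zeroʳ c) ⟩
  false ∎
  where open ≡-Reasoning

-- The first coordinate has degree at most 2, below k, and therefore sums to 0.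
wordSum-v : ∀ a b c {k} → 3 ≤ k → wordSum (L.map (λ w → v a b c w ∷ w) (allWords k)) ≡ zeros
wordSum-v a b c (s≤s (s≤s (s≤s {n = k} _))) = trans (wordSum-∷ (v a b c) (allWords (3 + k)))
  (cong₂ _∷_ (xorSum-v a b c (allWords (3 + k)) (xorSum-const (2 + k) a) (xorSum-e₁ (suc k)) (xorSum-e₂ k))
             (wordSum-allWords (suc k)))

remove-one : ∀ {n} (x : Word n) → x ≢ zeros → ∃ λ i → lookup x i ≡ true × wt x ≡ suc (wt (flipAt x i))
remove-one []          x≢0 = contradiction refl x≢0
remove-one (true ∷ x)  _   = zero , refl , refl
remove-one (false ∷ x) x≢0 with i , p , q ← remove-one x (x≢0 ∘ cong (false ∷_)) = suc i , p , q

-- Transvections of the polar form.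

transvection : ∀ {k} → Word k → Word k → Word k
transvection u x = x ⊕ polar x u · u

transvection-⊕ : ∀ {k} (u x y : Word k) → transvection u (x ⊕ y) ≡ transvection u x ⊕ transvection u y
transvection-⊕ u x y = begin
  (x ⊕ y) ⊕ polar (x ⊕ y) u · u                   ≡⟨ cong (λ b → (x ⊕ y) ⊕ b · u) (polar-⊕ˡ x y u) ⟩
  (x ⊕ y) ⊕ (polar x u xor polar y u) · u         ≡⟨ cong ((x ⊕ y) ⊕_) (·-xor (polar x u) (polar y u) u) ⟩
  (x ⊕ y) ⊕ (polar x u · u ⊕ polar y u · u)       ≡⟨ ⊕-interchange x y _ _ ⟩
  (x ⊕ polar x u · u) ⊕ (y ⊕ polar y u · u)       ∎
  where open ≡-Reasoning

-- The form is alternating, so adding u does not change the pairing with u. A second application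
-- then adds the same multiple of u and undoes the first.
polar-transvection : ∀ {k} (u x : Word k) → polar (transvection u x) u ≡ polar x u
polar-transvection u x with polar x u in eq
... | false = trans (cong (λ z → polar z u) (⊕-identityʳ x)) eq
... | true  = trans (polar-⊕ˡ x u u) (cong₂ _xor_ eq (polar-self u))

transvection-involutive : ∀ {k} (u x : Word k) → transvection u (transvection u x) ≡ x
transvection-involutive u x =
  trans (cong (λ b → transvection u x ⊕ b · u) (polar-transvection u x)) (⊕-cancelʳ x (polar x u · u))

transvection-zeros : ∀ {k} (u : Word k) → transvection u zeros ≡ zeros
transvection-zeros u = trans (cong (λ b → zeros ⊕ b · u) (trans (polar-sym zeros u) (polar-zerosʳ u))) (⊕-self zeros)

transvection-≢zeros : ∀ {k} (u : Word k) {x} → x ≢ zeros → transvection u x ≢ zeros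
transvection-≢zeros u {x} x≢0 p =
  x≢0 (trans (sym (transvection-involutive u x)) (trans (cong (transvection u) p) (transvection-zeros u)))

-- With direction x ⊕ y the alternating form gives B(x, x+y) = B(x,y) = 1, and x moves to x + (x +
-- y) = y.
transvection-move : ∀ {k} (x y : Word k) → polar x y ≡ true → transvection (x ⊕ y) x ≡ y
transvection-move x y p = trans
  (cong (λ b → x ⊕ b · (x ⊕ y)) (trans (polar-⊕ʳ x x y) (cong₂ _xor_ (polar-self x) p)))
  (⊕-cancelˡ x y)

K*2≡2^m⇒0<K : ∀ m K → K * 2 ≡ 2 ^ m → 0 < K
K*2≡2^m⇒0<K m zero    p = contradiction p (ℕ.<⇒≢ (ℕ.m^n>0 2 m))
K*2≡2^m⇒0<K m (suc K) _ = s≤s z≤n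

[K+2]*2≡2^m⇒0<K : ∀ {m} → 3 ≤ m → ∀ K → (K + 2) * 2 ≡ 2 ^ m → 0 < K
-- K = 0 would make 2^m equal to 4, whereas m ≥ 3 gives at least 8; `m≤m+n 5 3` is the inequality 4
-- < 8.
[K+2]*2≡2^m⇒0<K 3≤m zero    p = contradiction p (ℕ.<⇒≢ (ℕ.<-≤-trans (ℕ.m≤m+n 5 3) (ℕ.^-monoʳ-≤ 2 3≤m)))
[K+2]*2≡2^m⇒0<K 3≤m (suc K) _ = s≤s z≤n

-- The code of an extended row: classes of syndromes.

module Extended {n m : ℕ} (h : Fin n → Word m) (h≢0 : ∀ i → h i ≢ zeros)
  (h-injective : ∀ {i j} → h i ≡ h j → i ≡ j) (h-surjective : ∀ w → w ≢ zeros → ∃ λ i → h i ≡ w)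
  (i₀ : Fin n) (even : m % 2 ≡ 0) (a b c : Bool) (nonlinear : a ∨ c ≡ true) (3≤m : 3 ≤ m)
  (H : Fin n → Word (suc m)) (H-column : ∀ i → H i ≡ v a b c (h i) ∷ h i) where

  private
    q : Word m → Bool
    q = v a b c
    C : Code n
    C = kernel H
    S : Word n → Word (suc m)
    S = syndrome H

  words-↭ : zeros L.∷ L.map h (allFin n) ↭ allWords m
  words-↭ = ↭-allWords
    (All.tabulate (λ w∈ 0≡w → let i , _ , w≡hi = ∈-map⁻ h w∈ in h≢0 i (sym (trans 0≡w w≡hi)))
      ∷ map⁺ h-injective (allFin⁺ n))
    complete
    where
    complete : ∀ w → w ∈ zeros L.∷ L.map h (allFin n)
    complete w with w ≟ zeros
    ... | yes w≡0 = here w≡0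
    ... | no  w≢0 with i , refl ← h-surjective w w≢0 = there (∈-map⁺ h (∈-allFin i))

  count-columns : (P : Word m → Bool) → bit (P zeros) + count (P ∘ h) (allFin n) ≡ count P (allWords m)
  count-columns P = trans (cong (bit (P zeros) +_) (sym (count-map P h (allFin n)))) (count-↭ P words-↭)

  -- The deviation of `q` from additivity. The sum of two distinct columns over x and y is again a
  -- column exactly when it is 0.
  κ : Word m → Word m → Bool
  κ x y = a xor (c ∧ polar x y)

  v-zeros : q zeros ≡ a
  v-zeros = trans (cong₂ (λ s t → a xor ((b ∧ s) xor (c ∧ t))) (e₁-zeros m) (e₂-zeros m))
    (trans (cong (a xor_) (cong₂ _xor_ (∧-zeroʳ b) (∧-zeroʳ c))) (xor-identityʳ a))

  v-⊕ : ∀ x y → q (x ⊕ y) ≡ (q x xor q y) xor κ x y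
  v-⊕ x y rewrite e₁-⊕ x y | e₂-⊕ x y =
    solve 8 (λ a b c s t s′ t′ p →
      a :+ (b :* (s :+ s′) :+ c :* ((t :+ t′) :+ p))
      := ((a :+ (b :* s :+ c :* t)) :+ (a :+ (b :* s′ :+ c :* t′))) :+ (a :+ c :* p))
      refl a b c (e₁ x) (e₂ x) (e₁ y) (e₂ y) (polar x y)

  weight : Word (suc m) → ℕ
  weight (e ∷ s) = if isZero s then (if e then 3 else 0) else (if e xor q s then 2 else 1)

  -- The bit e is relative: it tells whether the top bit differs from 0 at the origin, or from `q`
  -- over a column. Flipping it exchanges weight w with 3 - w, so each later count, uniform in e,
  -- settles two weights at once.
  data View : Word (suc m) → Set where
    origin : ∀ e → View (e ∷ zeros)
    column : ∀ e i → View ((e xor q (h i)) ∷ h i)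

  view : ∀ s → View s
  view (e ∷ s) with s ≟ zeros
  ... | yes refl = origin e
  ... | no  s≢0 with i , refl ← h-surjective s s≢0 =
    subst (λ d → View (d ∷ h i)) (xor-cancelʳ e (q (h i))) (column (e xor q (h i)) i)
    where
    xor-cancelʳ : ∀ a b → (a xor b) xor b ≡ a
    xor-cancelʳ a b = solve 2 (λ a b → (a :+ b) :+ b := a) refl a b

  weight-origin : ∀ e → weight (e ∷ zeros) ≡ (if e then 3 else 0)
  weight-origin e rewrite isZero-zeros m = refl

  weight-column : ∀ e i → weight ((e xor q (h i)) ∷ h i) ≡ (if e then 2 else 1)
  weight-column e i rewrite ≢⇒isZero (h≢0 i) =
    cong (λ d → if d then 2 else 1) (solve 2 (λ a b → (a :+ b) :+ b := a) refl e (q (h i)))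

  weight-origin-⊕ : ∀ e j → weight ((e ∷ zeros) ⊕ H j) ≡ (if e then 2 else 1)
  weight-origin-⊕ e j rewrite H-column j | ⊕-identityˡ (h j) = weight-column e j

  -- Adding column i itself leads to the origin with the same e. Any other column leads over h i ⊕ h
  -- j, where comparing the top bit with `q` of that sum changes e by κ.
  weight-column-⊕ : ∀ e i j → weight (((e xor q (h i)) ∷ h i) ⊕ H j) ≡
    (if isZero (h i ⊕ h j) then (if e then 3 else 0) else (if e xor κ (h i) (h j) then 2 else 1))
  weight-column-⊕ e i j =
    trans (cong (λ t → weight (((e xor q (h i)) ∷ h i) ⊕ t)) (H-column j)) (go (isZero (h i ⊕ h j)) refl)
    where
    near far : Bool
    near = (e xor q (h i)) xor q (h j)
    far  = near xor q (h i ⊕ h j)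
    near≡ : h i ≡ h j → near ≡ e
    near≡ p = trans (cong (λ x → (e xor q (h i)) xor q x) (sym p))
      (solve 2 (λ a b → (a :+ b) :+ b := a) refl e (q (h i)))
    far≡ : far ≡ e xor κ (h i) (h j)
    far≡ = trans (cong (near xor_) (v-⊕ (h i) (h j)))
      (solve 4 (λ e s t k → ((e :+ s) :+ t) :+ ((s :+ t) :+ k) := e :+ k) refl e (q (h i)) (q (h j)) (κ (h i) (h j)))
    go : ∀ z → isZero (h i ⊕ h j) ≡ z →
      (if z then (if near then 3 else 0) else (if far then 2 else 1))
      ≡ (if z then (if e then 3 else 0) else (if e xor κ (h i) (h j) then 2 else 1))
    go true  eq = cong (λ d → if d then 3 else 0) (near≡ (⊕-≡zeros (isZero⇒≡ eq)))
    go false eq = cong (λ d → if d then 2 else 1) far≡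

  -- Counting columns by orthogonality.

  isZero-self : ∀ i → isZero (h i ⊕ h i) ≡ true
  isZero-self i = ≡⇒isZero (⊕-self (h i))

  -- The columns y that lead from weight 1 to weight 2 over x are also those that lead from weight 2
  -- back to weight 1.
  cross : Word m → Word m → Bool
  cross x y = not (isZero (x ⊕ y)) ∧ κ x y

  count-equal : ∀ i → count (λ j → isZero (h i ⊕ h j)) (allFin n) ≡ 1
  count-equal i = begin
    count (λ j → isZero (h i ⊕ h j)) (allFin n)
      ≡⟨ cong (λ d → bit d + count (λ j → isZero (h i ⊕ h j)) (allFin n))
           (trans (cong isZero (⊕-identityʳ (h i))) (≢⇒isZero (h≢0 i))) ⟨
    bit (isZero (h i ⊕ zeros)) + count (λ j → isZero (h i ⊕ h j)) (allFin n)
      ≡⟨ count-columns (λ w → isZero (h i ⊕ w)) ⟩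
    count (λ w → isZero (h i ⊕ w)) (allWords m)
      ≡⟨ count-translate isZero (h i) ⟩
    count isZero (allWords m)
      ≡⟨ count-isZero m ⟩
    1 ∎
    where open ≡-Reasoning

  -- Half of the space is orthogonal to h i. The 2 restores the two orthogonal vectors that the
  -- count omits: 0, which is not a column, and h i itself.
  count-orthogonal : ∀ i → (count (λ j → not (isZero (h i ⊕ h j)) ∧ not (polar (h i) (h j))) (allFin n) + 2) * 2 ≡ 2 ^ m
  count-orthogonal i = trans (cong (_* 2) K+2) (trans (cong (_* 2) (sym half)) full)
    where
    x : Word m
    x = h i
    half = proj₁ (count-polar even x (h≢0 i))
    full = proj₂ (count-polar even x (h≢0 i))
    P : Word m → Bool
    P w = not (isZero (x ⊕ w)) ∧ not (polar x w)
    K = count (P ∘ h) (allFin n)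
    P-zeros : P zeros ≡ true
    P-zeros rewrite ⊕-identityʳ x | ≢⇒isZero (h≢0 i) | polar-zerosʳ x = refl
    split : ∀ w → bit (isZero (x ⊕ w)) + bit (P w) ≡ bit (not (polar x w))
    split w with isZero (x ⊕ w) in eq
    ... | false = refl
    ... | true rewrite sym (⊕-≡zeros {x = x} {w} (isZero⇒≡ eq)) | polar-self x = refl
    open ≡-Reasoning
    K+2 : K + 2 ≡ count (not ∘ polar x) (allWords m)
    K+2 = begin
      K + 2                          ≡⟨ ℕ.+-comm K 2 ⟩
      1 + (1 + K)                    ≡⟨ cong (λ d → 1 + (bit d + K)) P-zeros ⟨
      1 + (bit (P zeros) + K)        ≡⟨ cong₂ _+_ (trans (sym (count-isZero m)) (sym (count-translate isZero x))) (count-columns P) ⟩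
      count (λ w → isZero (x ⊕ w)) (allWords m) + count P (allWords m)
        ≡⟨ count-disjoint (λ w → isZero (x ⊕ w)) P (not ∘ polar x) split (allWords m) ⟩
      count (not ∘ polar x) (allWords m) ∎

  -- Both omitted vectors, 0 and h i, are orthogonal to h i, so the full half remains.
  count-nonorthogonal : ∀ i → count (λ j → not (isZero (h i ⊕ h j)) ∧ polar (h i) (h j)) (allFin n) * 2 ≡ 2 ^ m
  count-nonorthogonal i = trans (cong (_* 2) (begin
    count (P ∘ h) (allFin n)                    ≡⟨ cong (λ d → bit d + count (P ∘ h) (allFin n)) P-zeros ⟨
    bit (P zeros) + count (P ∘ h) (allFin n)    ≡⟨ count-columns P ⟩
    count P (allWords m)                        ≡⟨ count-cong P≗polar (allWords m) ⟩
    count (polar x) (allWords m)                ∎)) (proj₂ (count-polar even x (h≢0 i)))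
    where
    x : Word m
    x = h i
    P : Word m → Bool
    P w = not (isZero (x ⊕ w)) ∧ polar x w
    P≗polar : ∀ w → P w ≡ polar x w
    P≗polar w with isZero (x ⊕ w) in eq
    ... | false = refl
    ... | true rewrite sym (⊕-≡zeros {x = x} {w} (isZero⇒≡ eq)) | polar-self x = refl
    P-zeros : P zeros ≡ false
    P-zeros = trans (P≗polar zeros) (polar-zerosʳ x)
    open ≡-Reasoning

  count-cross-orthogonal : a ≡ true → c ≡ true → ∀ i → (count (cross (h i) ∘ h) (allFin n) + 2) * 2 ≡ 2 ^ m
  count-cross-orthogonal a≡true c≡true i = trans
    (cong (λ K → (K + 2) * 2) (count-cong
      (λ j → cong₂ (λ a c → not (isZero (h i ⊕ h j)) ∧ (a xor (c ∧ polar (h i) (h j)))) a≡true c≡true) (allFin n)))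
    (count-orthogonal i)

  count-cross-nonorthogonal : a ≡ false → c ≡ true → ∀ i → count (cross (h i) ∘ h) (allFin n) * 2 ≡ 2 ^ m
  count-cross-nonorthogonal a≡false c≡true i = trans
    (cong (_* 2) (count-cong
      (λ j → cong₂ (λ a c → not (isZero (h i ⊕ h j)) ∧ (a xor (c ∧ polar (h i) (h j)))) a≡false c≡true) (allFin n)))
    (count-nonorthogonal i)

  -- The descent from weight 2. If a is 1, a column orthogonal to h i and distinct from it has κ = 1
  -- for either c; if a is 0, then c is 1 and a nonorthogonal column serves. Such columns exist
  -- because the counts are positive.
  crossing : ∀ i → ∃ λ j → isZero (h i ⊕ h j) ≡ false × κ (h i) (h j) ≡ true
  crossing i = go a c nonlinear
    where
    go : ∀ a c → a ∨ c ≡ true →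
      ∃ λ j → isZero (h i ⊕ h j) ≡ false × a xor (c ∧ polar (h i) (h j)) ≡ true
    go false true _ with j , p ← count-positive _ (allFin n) (K*2≡2^m⇒0<K m _ (count-nonorthogonal i))
      with isZero (h i ⊕ h j) in eq
    ... | false = j , eq , p
    go true c _ with j , p ← count-positive _ (allFin n) ([K+2]*2≡2^m⇒0<K 3≤m _ (count-orthogonal i))
      with isZero (h i ⊕ h j) in eq | polar (h i) (h j) in eq′
    ... | false | false = j , eq , cong not (trans (cong (c ∧_) eq′) (∧-zeroʳ c))

  -- The class weight is the coset weight.

  weight-zeros : weight zeros ≡ 0
  weight-zeros = weight-origin false

  weight≡0 : ∀ s → weight s ≡ 0 → s ≡ zeros
  weight≡0 s p with view s
  ... | origin false = refl
  ... | origin true  with () ← trans (sym (weight-origin true)) p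
  ... | column false i with () ← trans (sym (weight-column false i)) p
  ... | column true  i with () ← trans (sym (weight-column true i)) p

  weight-≤ : ∀ s → weight s ≤ 3
  weight-≤ s with view s
  ... | origin false   = subst (_≤ 3) (sym (weight-origin false)) z≤n
  ... | origin true    = ℕ.≤-reflexive (weight-origin true)
  ... | column false i = subst (_≤ 3) (sym (weight-column false i)) (s≤s z≤n)
  ... | column true  i = subst (_≤ 3) (sym (weight-column true i)) (s≤s (s≤s z≤n))

  weight-lipschitz : ∀ s j → weight (s ⊕ H j) ≤ suc (weight s)
  -- Adding a column is an involution, so the bound is proved from the other end t. Only weights 3
  -- and 2 then need an argument: all neighbours of weight 3 have weight 2, and no neighbour of
  -- weight 2 has weight 0.
  weight-lipschitz s j = subst (λ t → weight (s ⊕ H j) ≤ suc (weight t)) (⊕-cancelʳ s (H j)) (go (s ⊕ H j))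
    where
    go : ∀ t → weight t ≤ suc (weight (t ⊕ H j))
    go t with view t
    ... | origin false   = subst (_≤ suc (weight ((false ∷ zeros) ⊕ H j))) (sym (weight-origin false)) z≤n
    ... | origin true    = ℕ.≤-reflexive (trans (weight-origin true) (cong suc (sym (weight-origin-⊕ true j))))
    ... | column false i = subst (_≤ suc (weight (((false xor q (h i)) ∷ h i) ⊕ H j))) (sym (weight-column false i)) (s≤s z≤n)
    ... | column true  i = subst₂ (λ d d′ → d ≤ suc d′) (sym (weight-column true i)) (sym (weight-column-⊕ true i j))
      (positive (isZero (h i ⊕ h j)) (κ (h i) (h j)))
      where
      positive : ∀ z k → 2 ≤ suc (if z then 3 else (if not k then 2 else 1))
      positive true  k     = s≤s (s≤s z≤n)
      positive false true  = s≤s (s≤s z≤n)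
      positive false false = s≤s (s≤s z≤n)

  weight-descent : ∀ s k → weight s ≡ suc k → ∃ λ j → weight (s ⊕ H j) ≡ k
  weight-descent s k p with view s
  ... | origin false with () ← trans (sym (weight-origin false)) p
  ... | origin true  with refl ← trans (sym (weight-origin true)) p = i₀ , weight-origin-⊕ true i₀
  ... | column false i with refl ← trans (sym (weight-column false i)) p = i
    , trans (weight-column-⊕ false i i)
            (cong (λ z → if z then 0 else (if κ (h i) (h i) then 2 else 1)) (isZero-self i))
  ... | column true  i with refl ← trans (sym (weight-column true i)) p | j , i≢j , κ≡true ← crossing i = j
    , trans (weight-column-⊕ true i j)
            (cong₂ (λ z k → if z then 3 else (if not k then 2 else 1)) i≢j κ≡true)

  open CosetWeight H weight weight-zeros weight≡0 weight-lipschitz weight-descent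

  coveringRadius≡3 : coveringRadius C ≡ 3
  coveringRadius≡3 = coveringRadius-δ weight-≤ (true ∷ zeros) (weight-origin true)

  -- The intersection array.

  count-columns-≡ᵇ : ∀ d → count (λ (_ : Fin n) → d ≡ᵇ d) (allFin n) ≡ n
  count-columns-≡ᵇ d = trans (count-cong (λ _ → ≡ᵇ-refl d) (allFin n)) (trans (count-true (allFin n)) (length-tabulate {n = n} id))
    where
    ≡ᵇ-refl : ∀ d → (d ≡ᵇ d) ≡ true
    ≡ᵇ-refl zero    = refl
    ≡ᵇ-refl (suc d) = ≡ᵇ-refl d

  -- Gives b₀ for e false and c₃ for e true: every column leaves the origin for the class with the
  -- same e.
  neighbours-origin : ∀ e → count (λ j → weight ((e ∷ zeros) ⊕ H j) ≡ᵇ (if e then 2 else 1)) (allFin n) ≡ n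
  neighbours-origin e = trans
    (count-cong (λ j → cong (_≡ᵇ (if e then 2 else 1)) (weight-origin-⊕ e j)) (allFin n))
    (count-columns-≡ᵇ (if e then 2 else 1))

  -- Gives c₁ for e false and b₂ for e true: only column i cancels h i.
  neighbours-column-origin : ∀ e i →
    count (λ j → weight (((e xor q (h i)) ∷ h i) ⊕ H j) ≡ᵇ (if e then 3 else 0)) (allFin n) ≡ 1
  neighbours-column-origin e i = trans
    (count-cong (λ j → trans (cong (_≡ᵇ (if e then 3 else 0)) (weight-column-⊕ e i j))
                             (go e (isZero (h i ⊕ h j)) (κ (h i) (h j)))) (allFin n))
    (count-equal i)
    where
    go : ∀ e z k → ((if z then (if e then 3 else 0) else (if e xor k then 2 else 1)) ≡ᵇ (if e then 3 else 0)) ≡ z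
    go false false false = refl
    go false false true  = refl
    go false true  k     = refl
    go true  false false = refl
    go true  false true  = refl
    go true  true  k     = refl

  -- Gives b₁ for e false and c₂ for e true, whence the symmetry of the array.
  neighbours-column-column : ∀ e i →
    count (λ j → weight (((e xor q (h i)) ∷ h i) ⊕ H j) ≡ᵇ (if e then 1 else 2)) (allFin n)
    ≡ count (cross (h i) ∘ h) (allFin n)
  neighbours-column-column e i =
    count-cong (λ j → trans (cong (_≡ᵇ (if e then 1 else 2)) (weight-column-⊕ e i j))
                            (go e (isZero (h i ⊕ h j)) (κ (h i) (h j)))) (allFin n)
    where
    go : ∀ e z k → ((if z then (if e then 3 else 0) else (if e xor k then 2 else 1)) ≡ᵇ (if e then 1 else 2)) ≡ not z ∧ k
    go false false false = refl
    go false false true  = refl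
    go false true  k     = refl
    go true  false false = refl
    go true  false true  = refl
    go true  true  k     = refl

  intersectionArray : ∀ K → (∀ i → count (cross (h i) ∘ h) (allFin n) ≡ K) →
    HasIntersectionArray C (n ∷ K ∷ 1 ∷ []) (1 ∷ K ∷ n ∷ [])
  intersectionArray K cross≡K = coveringRadius≡3
    , (λ x l d → trans (nbrsIn-δ x (suc (toℕ l))) (up l (S x) (trans (sym (dist-δ x)) d)))
    , (λ x l d → trans (nbrsIn-δ x (toℕ l)) (down l (S x) (trans (sym (dist-δ x)) d)))
    where
    up : ∀ (l : Fin 3) s → weight s ≡ toℕ l →
      count (λ j → weight (s ⊕ H j) ≡ᵇ suc (toℕ l)) (allFin n) ≡ lookup (n ∷ K ∷ 1 ∷ []) l
    up l s p with view s
    up zero             _ p | origin false   = neighbours-origin false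
    up (suc zero)       _ p | origin false with () ← trans (sym (weight-origin false)) p
    up (suc (suc zero)) _ p | origin false with () ← trans (sym (weight-origin false)) p
    up zero             _ p | origin true with () ← trans (sym (weight-origin true)) p
    up (suc zero)       _ p | origin true with () ← trans (sym (weight-origin true)) p
    up (suc (suc zero)) _ p | origin true with () ← trans (sym (weight-origin true)) p
    up zero             _ p | column false i with () ← trans (sym (weight-column false i)) p
    up (suc zero)       _ p | column false i = trans (neighbours-column-column false i) (cross≡K i)
    up (suc (suc zero)) _ p | column false i with () ← trans (sym (weight-column false i)) p
    up zero             _ p | column true i with () ← trans (sym (weight-column true i)) p
    up (suc zero)       _ p | column true i with () ← trans (sym (weight-column true i)) p
    up (suc (suc zero)) _ p | column true i = neighbours-column-origin true i
    down : ∀ (l : Fin 3) s → weight s ≡ suc (toℕ l) →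
      count (λ j → weight (s ⊕ H j) ≡ᵇ toℕ l) (allFin n) ≡ lookup (1 ∷ K ∷ n ∷ []) l
    down l s p with view s
    down l                _ p | origin false with () ← trans (sym (weight-origin false)) p
    down zero             _ p | origin true with () ← trans (sym (weight-origin true)) p
    down (suc zero)       _ p | origin true with () ← trans (sym (weight-origin true)) p
    down (suc (suc zero)) _ p | origin true    = neighbours-origin true
    down zero             _ p | column false i = neighbours-column-origin false i
    down (suc zero)       _ p | column false i with () ← trans (sym (weight-column false i)) p
    down (suc (suc zero)) _ p | column false i with () ← trans (sym (weight-column false i)) p
    down zero             _ p | column true i with () ← trans (sym (weight-column true i)) p
    down (suc zero)       _ p | column true i = trans (neighbours-column-column true i) (cross≡K i)
    down (suc (suc zero)) _ p | column true i with () ← trans (sym (weight-column true i)) p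

  -- The vectors (q w, w) over all w sum to 0, and the columns miss only the one over w = 0, namely
  -- (a, 0).
  syndrome-ones≡a : S ones ≡ a ∷ zeros
  syndrome-ones≡a = begin
    S ones                                          ≡⟨ syndrome-ones H ⟩
    wordSum (L.map H (allFin n))                    ≡⟨ cong wordSum (map-cong H-column (allFin n)) ⟩
    wordSum (L.map (λ i → extend (h i)) (allFin n)) ≡⟨ cong wordSum (map-∘ (allFin n)) ⟩
    T                                               ≡⟨ ⊕-cancelˡ (extend zeros) T ⟨
    extend zeros ⊕ (extend zeros ⊕ T)               ≡⟨ cong (extend zeros ⊕_) (wordSum-↭ (↭-map⁺ extend words-↭)) ⟩
    extend zeros ⊕ wordSum (L.map extend (allWords m))
                                                    ≡⟨ cong (extend zeros ⊕_) (wordSum-v a b c 3≤m) ⟩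
    extend zeros ⊕ zeros                            ≡⟨ ⊕-identityʳ (extend zeros) ⟩
    extend zeros                                    ≡⟨ cong (_∷ zeros) v-zeros ⟩
    a ∷ zeros                                       ∎
    where
    open ≡-Reasoning
    extend : Word m → Word (suc m)
    extend w = q w ∷ w
    T = wordSum (L.map extend (L.map h (allFin n)))

  C-ones : C ones ≡ not a
  C-ones = trans (kernel-syndrome H ones) (trans (cong isZero syndrome-ones≡a)
    (trans (cong (not a ∧_) (isZero-zeros m)) (∧-identityʳ (not a))))

  -- Transvections as automorphisms, and the orbits.

  -- A transvection preserves the polar form but not q, which it changes by a multiple of polar _ u;
  -- the extra coordinate absorbs this linear defect.
  defect : Word m → Bool
  defect u = q u xor (a xor c)

  v-transvection : ∀ u x → q (transvection u x) ≡ q x xor (defect u ∧ polar x u)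
  v-transvection u x = go (polar x u) refl
    where
    go : ∀ p → polar x u ≡ p → q (x ⊕ p · u) ≡ q x xor (defect u ∧ p)
    go false _ = trans (cong q (⊕-identityʳ x)) (sym (trans (cong (q x xor_) (∧-zeroʳ (defect u))) (xor-identityʳ (q x))))
    go true  p = begin
      q (x ⊕ u)                                    ≡⟨ v-⊕ x u ⟩
      (q x xor q u) xor (a xor (c ∧ polar x u))    ≡⟨ cong (λ p → (q x xor q u) xor (a xor (c ∧ p))) p ⟩
      (q x xor q u) xor (a xor (c ∧ true))         ≡⟨ cong (λ d → (q x xor q u) xor (a xor d)) (∧-identityʳ c) ⟩
      (q x xor q u) xor (a xor c)                  ≡⟨ xor-assoc (q x) (q u) _ ⟩
      q x xor defect u                             ≡⟨ cong (q x xor_) (∧-identityʳ (defect u)) ⟨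
      q x xor (defect u ∧ true)                    ∎
      where open ≡-Reasoning

  lift : Word m → Word (suc m) → Word (suc m)
  lift u (e ∷ s) = (e xor (defect u ∧ polar s u)) ∷ transvection u s

  lift-⊕ : ∀ u s t → lift u (s ⊕ t) ≡ lift u s ⊕ lift u t
  lift-⊕ u (d ∷ s) (e ∷ t) = cong₂ _∷_
    (trans (cong (λ p → (d xor e) xor (defect u ∧ p)) (polar-⊕ˡ s t u))
      (solve 5 (λ d e k p p′ → (d :+ e) :+ k :* (p :+ p′) := (d :+ k :* p) :+ (e :+ k :* p′))
        refl d e (defect u) (polar s u) (polar t u)))
    (transvection-⊕ u s t)

  lift-involutive : ∀ u s → lift u (lift u s) ≡ s
  lift-involutive u (e ∷ s) = cong₂ _∷_
    (trans (cong (λ p → (e xor (defect u ∧ polar s u)) xor (defect u ∧ p)) (polar-transvection u s))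
      (solve 2 (λ e k → (e :+ k) :+ k := e) refl e (defect u ∧ polar s u)))
    (transvection-involutive u s)

  -- The correction in the first coordinate is exactly the change of `q` under the transvection, so
  -- the class bit e is kept. With e false this says that columns go to columns.
  lift-column : ∀ u e x → lift u ((e xor q x) ∷ x) ≡ (e xor q (transvection u x)) ∷ transvection u x
  lift-column u e x = cong (_∷ transvection u x)
    (trans (xor-assoc e (q x) _) (cong (e xor_) (sym (v-transvection u x))))

  shift : Word m → Fin n → Fin n
  shift u i = proj₁ (h-surjective (transvection u (h i)) (transvection-≢zeros u (h≢0 i)))

  h-shift : ∀ u i → h (shift u i) ≡ transvection u (h i)
  h-shift u i = proj₂ (h-surjective (transvection u (h i)) (transvection-≢zeros u (h≢0 i)))

  shift-involutive : ∀ u i → shift u (shift u i) ≡ i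
  shift-involutive u i = h-injective
    (trans (h-shift u (shift u i)) (trans (cong (transvection u) (h-shift u i)) (transvection-involutive u (h i))))

  SameOrbit-transvection : ∀ u x y → S y ≡ lift u (S x) → SameOrbit C x y
  SameOrbit-transvection u = SameOrbit-linear H
    (permutation (shift u) (shift u) (shift-involutive u) (shift-involutive u))
    (lift u) (lift-⊕ u) (lift-involutive u)
    (λ i → begin
      H (shift u i)                                 ≡⟨ H-column (shift u i) ⟩
      q (h (shift u i)) ∷ h (shift u i)             ≡⟨ cong (λ w → q w ∷ w) (h-shift u i) ⟩
      q (transvection u (h i)) ∷ transvection u (h i) ≡⟨ lift-column u false (h i) ⟨
      lift u (q (h i) ∷ h i)                        ≡⟨ cong (lift u) (H-column i) ⟨
      lift u (H i)                                  ∎)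
    where open ≡-Reasoning

  word : Word (suc m) → Word n
  word s = proj₁ (leader s)

  syndrome-word : ∀ s → S (word s) ≡ s
  syndrome-word s = proj₁ (proj₂ (leader s))

  SameOrbit-move : ∀ e x y → polar x y ≡ true → ∀ v w → S v ≡ (e xor q x) ∷ x → S w ≡ (e xor q y) ∷ y → SameOrbit C v w
  SameOrbit-move e x y p v w Sv Sw = SameOrbit-transvection (x ⊕ y) v w (begin
    S w                                                   ≡⟨ Sw ⟩
    (e xor q y) ∷ y                                       ≡⟨ cong (λ z → (e xor q z) ∷ z) (transvection-move x y p) ⟨
    (e xor q (transvection (x ⊕ y) x)) ∷ transvection (x ⊕ y) x ≡⟨ lift-column (x ⊕ y) e x ⟨
    lift (x ⊕ y) ((e xor q x) ∷ x)                        ≡⟨ cong (lift (x ⊕ y)) Sv ⟨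
    lift (x ⊕ y) (S v)                                    ∎)
    where open ≡-Reasoning

  -- No transvection takes x to a different y orthogonal to it, so the path goes through a z
  -- orthogonal to neither.
  SameOrbit-column : ∀ e x y → x ≢ zeros → y ≢ zeros → ∀ v w → S v ≡ (e xor q x) ∷ x → S w ≡ (e xor q y) ∷ y →
    SameOrbit C v w
  SameOrbit-column e x y x≢0 y≢0 v w Sv Sw with z , xz , yz ← polar-common even x y x≢0 y≢0 =
    SameOrbit-trans H v t w
      (SameOrbit-move e x z xz v t Sv (syndrome-word _))
      (SameOrbit-move e z y (trans (polar-sym z y) yz) t w (syndrome-word _) Sw)
    where
    t : Word n
    t = word ((e xor q z) ∷ z)

  -- The radius is a variable because `CompletelyTransitive` has `coveringRadius C` in a vector
  -- length, and that equals 3 only propositionally; the result is transported along the equation.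
  OrbitRepresentatives : ℕ → Set
  OrbitRepresentatives ρ = Σ (Vec (Word n) (suc ρ)) λ reps →
    (∀ i j → SameOrbit C (lookup reps i) (lookup reps j) → i ≡ j) × (∀ w → ∃ λ i → SameOrbit C w (lookup reps i))

  orbitRepresentatives : OrbitRepresentatives 3
  orbitRepresentatives = reps , distinct , covers
    where
    syndromes : Vec (Word (suc m)) 4
    syndromes = (false ∷ zeros) ∷ ((false xor q (h i₀)) ∷ h i₀) ∷ ((true xor q (h i₀)) ∷ h i₀) ∷ (true ∷ zeros) ∷ []
    reps : Vec (Word n) 4
    reps = Data.Vec.map word syndromes
    weight-reps : ∀ i → weight (S (lookup reps i)) ≡ toℕ i
    weight-reps i = trans (cong (weight ∘ S) (lookup-map i word syndromes))
      (trans (cong weight (syndrome-word (lookup syndromes i))) (go i))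
      where
      go : ∀ i → weight (lookup syndromes i) ≡ toℕ i
      go zero                   = weight-origin false
      go (suc zero)             = weight-column false i₀
      go (suc (suc zero))       = weight-column true i₀
      go (suc (suc (suc zero))) = weight-origin true
    distinct : ∀ i j → SameOrbit C (lookup reps i) (lookup reps j) → i ≡ j
    distinct i j o = toℕ-injective
      (trans (sym (weight-reps i)) (trans (SameOrbit-δ (lookup reps i) (lookup reps j) o) (weight-reps j)))
    covers : ∀ w → ∃ λ i → SameOrbit C w (lookup reps i)
    covers w = go (S w) (view (S w)) refl
      where
      go : ∀ s → View s → S w ≡ s → ∃ λ i → SameOrbit C w (lookup reps i)
      go _ (origin false)   p = zero , SameOrbit-coset H w _ (trans p (sym (syndrome-word _)))
      go _ (column false i) p = suc zero , SameOrbit-column false (h i) (h i₀) (h≢0 i) (h≢0 i₀) w _ p (syndrome-word _)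
      go _ (column true i)  p = suc (suc zero) , SameOrbit-column true (h i) (h i₀) (h≢0 i) (h≢0 i₀) w _ p (syndrome-word _)
      go _ (origin true)    p = suc (suc (suc zero)) , SameOrbit-coset H w _ (trans p (sym (syndrome-word _)))

  completelyTransitive : CompletelyTransitive C
  completelyTransitive = subst OrbitRepresentatives (sym coveringRadius≡3) orbitRepresentatives

  -- Dimension and minimum distance.

  size≡ : size C * 2 ^ suc m ≡ 2 ^ n
  size≡ = size-kernel H (λ s → word s , syndrome-word s)

  module _ (κ≡true : ∀ x y → κ x y ≡ true) where

    -- Deleting two ones of a codeword leaves a word whose syndrome is the sum of two distinct
    -- columns. Since κ is 1, that sum has coset weight 2, so at least two more ones remain.
    4≤wt-codeword : ∀ e → e ≢ zeros → S e ≡ zeros → 4 ≤ wt e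
    4≤wt-codeword e e≢0 Se =
      let i , ei , wt-e   = remove-one e e≢0
          j , e′j , wt-e′ = remove-one (flipAt e i) (e′≢0 i)
      in subst (4 ≤_) (sym (trans wt-e (cong suc wt-e′)))
           (s≤s (s≤s (2≤wt i j (λ i≡j → distinct i j i≡j ei e′j))))
      where
      S-flipAt : ∀ i → S (flipAt e i) ≡ H i
      S-flipAt i = trans (syndrome-flipAt H e i) (trans (cong (_⊕ H i) Se) (⊕-identityˡ (H i)))
      e′≢0 : ∀ i → flipAt e i ≢ zeros
      e′≢0 i e′≡0 = h≢0 i (∷-injectiveʳ
        (trans (sym (H-column i)) (trans (sym (S-flipAt i)) (trans (cong S e′≡0) (syndrome-zeros H)))))
      distinct : ∀ i j → i ≡ j → lookup e i ≡ true → lookup (flipAt e i) j ≢ true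
      distinct i .i refl ei e′i with () ← trans (sym e′i) (trans (lookup∘updateAt i e) (cong not ei))
      2≤wt : ∀ i j → i ≢ j → 2 ≤ wt (flipAt (flipAt e i) j)
      2≤wt i j i≢j = subst (_≤ wt (flipAt (flipAt e i) j)) (begin
        weight (S (flipAt (flipAt e i) j))  ≡⟨ cong weight (syndrome-flipAt H (flipAt e i) j) ⟩
        weight (S (flipAt e i) ⊕ H j)       ≡⟨ cong (λ t → weight (t ⊕ H j)) (trans (S-flipAt i) (H-column i)) ⟩
        weight ((q (h i) ∷ h i) ⊕ H j)      ≡⟨ weight-column-⊕ false i j ⟩
        (if isZero (h i ⊕ h j) then 0 else (if κ (h i) (h j) then 2 else 1))
          ≡⟨ cong₂ (λ z k → if z then 0 else (if k then 2 else 1))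
               (≢⇒isZero (i≢j ∘ h-injective ∘ ⊕-≡zeros)) (κ≡true (h i) (h j)) ⟩
        2                                   ∎) (δ≤wt (flipAt (flipAt e i) j))
        where open ≡-Reasoning

    -- The codeword is supported on the columns over x, y, z and x + y + z. Four flips bound its
    -- weight by 4, and the lower bound for nonzero codewords forces equality; the conditions on x
    -- ensure that its coordinate is flipped just once, so the word is nonzero.
    minDistance≡4 : ∀ x y z → x ≢ zeros → y ≢ zeros → z ≢ zeros → (x ⊕ y) ⊕ z ≢ zeros →
      x ≢ y → x ≢ z → x ≢ (x ⊕ y) ⊕ z → MinDistance C 4
    minDistance≡4 x y z x≢0 y≢0 z≢0 t≢0 x≢y x≢z x≢t =
      (e , zeros , ⇒codeword H e Se , ⇒codeword H zeros (syndrome-zeros H) , e≢0 ,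
        trans (cong wt (⊕-identityʳ e)) (ℕ.≤-antisym wt-e (4≤wt-codeword e e≢0 Se)))
      , (λ v w Cv Cw v≢w → 4≤wt-codeword (v ⊕ w) (v≢w ∘ ⊕-≡zeros)
          (trans (syndrome-⊕ H v w) (trans (cong₂ _⊕_ (codeword⇒ H v Cv) (codeword⇒ H w Cw)) (⊕-self zeros))))
      where
      t : Word m
      t = (x ⊕ y) ⊕ z
      ix = h-surjective x x≢0
      iy = h-surjective y y≢0
      iz = h-surjective z z≢0
      it = h-surjective t t≢0
      y₁ y₂ y₃ e : Word n
      y₁ = flipAt zeros (proj₁ ix)
      y₂ = flipAt y₁ (proj₁ iy)
      y₃ = flipAt y₂ (proj₁ iz)
      e  = flipAt y₃ (proj₁ it)
      distinct : ∀ {u w} (i : ∃ λ i → h i ≡ u) (j : ∃ λ j → h j ≡ w) → u ≢ w → proj₁ i ≢ proj₁ j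
      distinct (i , refl) (j , refl) u≢w = u≢w ∘ cong h
      ex : lookup e (proj₁ ix) ≡ true
      ex = begin
        lookup e (proj₁ ix)    ≡⟨ lookup∘updateAt′ _ _ (distinct ix it x≢t) y₃ ⟩
        lookup y₃ (proj₁ ix)  ≡⟨ lookup∘updateAt′ _ _ (distinct ix iz x≢z) y₂ ⟩
        lookup y₂ (proj₁ ix)  ≡⟨ lookup∘updateAt′ _ _ (distinct ix iy x≢y) y₁ ⟩
        lookup y₁ (proj₁ ix)  ≡⟨ lookup∘updateAt (proj₁ ix) zeros ⟩
        not (lookup (zeros {n}) (proj₁ ix)) ≡⟨ cong not (lookup-replicate (proj₁ ix) false) ⟩
        true ∎
        where open ≡-Reasoning
      e≢0 : e ≢ zeros
      e≢0 e≡0 with () ← trans (sym ex) (trans (cong (λ e → lookup e (proj₁ ix)) e≡0) (lookup-replicate (proj₁ ix) false))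
      wt-e : wt e ≤ 4
      wt-e = ℕ.≤-trans (wt-flipAt-≤ y₃ _) (s≤s (ℕ.≤-trans (wt-flipAt-≤ y₂ _) (s≤s
        (ℕ.≤-trans (wt-flipAt-≤ y₁ _) (s≤s (ℕ.≤-trans (wt-flipAt-≤ (zeros {n}) (proj₁ ix)) (s≤s (ℕ.≤-reflexive (wt-zeros n)))))))))
      H-at : ∀ {w} (i : ∃ λ i → h i ≡ w) → H (proj₁ i) ≡ q w ∷ w
      H-at (i , refl) = H-column i
      q-t : q t ≡ (q x xor q y) xor q z
      q-t = begin
        q t                                      ≡⟨ v-⊕ (x ⊕ y) z ⟩
        (q (x ⊕ y) xor q z) xor κ (x ⊕ y) z      ≡⟨ cong₂ (λ d k → (d xor q z) xor k) (trans (v-⊕ x y) (cong ((q x xor q y) xor_) (κ≡true x y))) (κ≡true (x ⊕ y) z) ⟩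
        (((q x xor q y) xor true) xor q z) xor true
          -- Each of the two additions contributes κ = 1, and the two ones cancel.
          ≡⟨ solve 3 (λ d e k → ((d :+ k) :+ e) :+ k := d :+ e) refl (q x xor q y) (q z) true ⟩
        (q x xor q y) xor q z                    ∎
        where open ≡-Reasoning
      Se : S e ≡ zeros
      Se = begin
        S e                        ≡⟨ syndrome-flipAt H y₃ (proj₁ it) ⟩
        S y₃ ⊕ H (proj₁ it)       ≡⟨ cong₂ _⊕_ (trans (syndrome-flipAt H y₂ (proj₁ iz)) (cong₂ _⊕_
                                       (trans (syndrome-flipAt H y₁ (proj₁ iy)) (cong₂ _⊕_
                                         (trans (syndrome-flipAt H zeros (proj₁ ix))
                                           (trans (cong (_⊕ H (proj₁ ix)) (syndrome-zeros H)) (trans (⊕-identityˡ _) (H-at ix))))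
                                         (H-at iy))) (H-at iz)))
                                       (H-at it) ⟩
        (((q x xor q y) xor q z) xor q t) ∷ (t ⊕ t)
                                   ≡⟨ cong₂ _∷_ (trans (cong (((q x xor q y) xor q z) xor_) q-t) (xor-same ((q x xor q y) xor q z))) (⊕-self t) ⟩
        zeros                      ∎
        where open ≡-Reasoning

-- Rows of degree at most one.

syndrome-const-∷ : ∀ {n r} b (h : Fin n → Word r) x → syndrome (λ i → b ∷ h i) x ≡ (b ∧ e₁ x) ∷ syndrome h x
syndrome-const-∷ b h []          = cong (_∷ zeros) (sym (∧-zeroʳ b))
syndrome-const-∷ b h (false ∷ x) = cong (zeros ⊕_) (syndrome-const-∷ b (h ∘ suc) x)
syndrome-const-∷ b h (true ∷ x)  = trans (cong ((b ∷ h zero) ⊕_) (syndrome-const-∷ b (h ∘ suc) x))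
  (cong (_∷ (h zero ⊕ syndrome (h ∘ suc) x)) (go b (e₁ x)))
  where
  go : ∀ b k → b xor (b ∧ k) ≡ b ∧ not k
  go false k = refl
  go true  k = refl

-- For c = 0 the appended row is the constant a plus a linear combination of the rows of h.
kernel-linear : ∀ {n m} (h : Fin n → Word m) (a b : Bool) (H : Fin n → Word (suc m)) →
  (∀ i → H i ≡ v a b false (h i) ∷ h i) → ∀ x → kernel H x ≡ not (a ∧ e₁ x) ∧ kernel h x
kernel-linear {n} {m} h a b H H-column x = begin
  kernel H x                                 ≡⟨ kernel-syndrome H x ⟩
  isZero (syndrome H x)                      ≡⟨ cong isZero (trans (syndrome-cong H-column′ x) (syndrome-map (λ i → a ∷ h i) shear shear-0 shear-⊕ x)) ⟩
  isZero (shear (syndrome (λ i → a ∷ h i) x)) ≡⟨ cong (isZero ∘ shear) (syndrome-const-∷ a h x) ⟩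
  isZero (shear ((a ∧ e₁ x) ∷ syndrome h x)) ≡⟨ isZero-shear (a ∧ e₁ x) (syndrome h x) ⟩
  not (a ∧ e₁ x) ∧ isZero (syndrome h x)     ≡⟨ cong (not (a ∧ e₁ x) ∧_) (kernel-syndrome h x) ⟨
  not (a ∧ e₁ x) ∧ kernel h x                ∎
  where
  open ≡-Reasoning
  shear : Word (suc m) → Word (suc m)
  shear (d ∷ s) = (d xor (b ∧ e₁ s)) ∷ s
  H-column′ : ∀ i → H i ≡ shear (a ∷ h i)
  H-column′ i = trans (H-column i) (cong (λ d → (a xor d) ∷ h i) (xor-identityʳ (b ∧ e₁ (h i))))
  shear-0 : shear zeros ≡ zeros
  shear-0 = cong (_∷ zeros) (trans (cong (b ∧_) (e₁-zeros m)) (∧-zeroʳ b))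
  shear-⊕ : ∀ s t → shear (s ⊕ t) ≡ shear s ⊕ shear t
  shear-⊕ (d ∷ s) (e ∷ t) = cong (_∷ (s ⊕ t)) (trans (cong (λ p → (d xor e) xor (b ∧ p)) (e₁-⊕ s t))
    (solve 5 (λ d e k p p′ → (d :+ e) :+ k :* (p :+ p′) := (d :+ k :* p) :+ (e :+ k :* p′)) refl d e b (e₁ s) (e₁ t)))
  isZero-shear : ∀ d s → isZero (shear (d ∷ s)) ≡ not d ∧ isZero s
  isZero-shear d s with isZero s in eq
  ... | false = trans (∧-zeroʳ _) (sym (∧-zeroʳ (not d)))
  ... | true rewrite isZero⇒≡ {x = s} eq = cong (λ p → not p ∧ true)
    (trans (cong (d xor_) (trans (cong (b ∧_) (e₁-zeros m)) (∧-zeroʳ b))) (xor-identityʳ d))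

-- Weights modulo 2 and 4, and the six rows.

wt%2 : ∀ {k} (x : Word k) → (wt x % 2 ≡ᵇ 0) ≡ not (e₁ x)
wt%2 x with q , p ← wt-digits x = trans (cong (λ d → d % 2 ≡ᵇ 0) (trans p (cong (bit (e₁ x) + bit (e₂ x) * 2 +_) (sym (ℕ.*-assoc q 2 2)))))
  (trans (cong (_≡ᵇ 0) ([m+kn]%n≡m%n (bit (e₁ x) + bit (e₂ x) * 2) (q * 2) 2)) (go (e₁ x) (e₂ x)))
  where
  go : ∀ s t → ((bit s + bit t * 2) % 2 ≡ᵇ 0) ≡ not s
  go true  true  = refl
  go true  false = refl
  go false true  = refl
  go false false = refl

-- The record lets unification recover a, b and c from the type of a row; the bare equation would
-- unfold `v` and lose them.
record RowOf (i₁ i₂ : ℕ) (a b c : Bool) : Set where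
  constructor rowOf
  field value : ∀ {k} (w : Word k) → (wt w % 4 ≡ᵇ i₁) ∨ (wt w % 4 ≡ᵇ i₂) ≡ v a b c w

open RowOf

row-digits : ∀ i₁ i₂ a b c →
  (∀ s t → let d = (bit s + bit t * 2) % 4 in (d ≡ᵇ i₁) ∨ (d ≡ᵇ i₂) ≡ a xor ((b ∧ s) xor (c ∧ t))) → RowOf i₁ i₂ a b c
row-digits i₁ i₂ a b c table = rowOf λ w →
  trans (cong (λ d → (d ≡ᵇ i₁) ∨ (d ≡ᵇ i₂)) (wt%4 w)) (table (e₁ w) (e₂ w))

row-pair : ∀ {i₁ i₂ j₁ j₂ a b c} → RowOf j₁ j₂ a b c → PairIs i₁ i₂ j₁ j₂ → RowOf i₁ i₂ a b c
row-pair row (inj₁ (refl , refl)) = row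
row-pair {i₁} {i₂} row (inj₂ (refl , refl)) = rowOf λ w → trans (∨-comm (wt w % 4 ≡ᵇ i₁) _) (value row w)

row₀₁ : RowOf 0 1 true false true
row₀₁ = row-digits 0 1 true false true λ where
  true  true  → refl
  true  false → refl
  false true  → refl
  false false → refl

row₀₃ : RowOf 0 3 true true true
row₀₃ = row-digits 0 3 true true true λ where
  true  true  → refl
  true  false → refl
  false true  → refl
  false false → refl

row₁₂ : RowOf 1 2 false true true
row₁₂ = row-digits 1 2 false true true λ where
  true  true  → refl
  true  false → refl
  false true  → refl
  false false → refl

row₂₃ : RowOf 2 3 false false true
row₂₃ = row-digits 2 3 false false true λ where
  true  true  → refl
  true  false → refl
  false true  → refl
  false false → refl

row₀₂ : RowOf 0 2 true true false
row₀₂ = row-digits 0 2 true true false λ where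
  true  true  → refl
  true  false → refl
  false true  → refl
  false false → refl

row₁₃ : RowOf 1 3 false true false
row₁₃ = row-digits 1 3 false true false λ where
  true  true  → refl
  true  false → refl
  false true  → refl
  false false → refl

independentWords : ∀ {m} → 3 ≤ m → ∃₂ λ (x y : Word m) → ∃ λ z →
  x ≢ zeros × y ≢ zeros × z ≢ zeros × (x ⊕ y) ⊕ z ≢ zeros × x ≢ y × x ≢ z × x ≢ (x ⊕ y) ⊕ z
independentWords (s≤s (s≤s (s≤s _))) =
  true ∷ false ∷ false ∷ zeros , false ∷ true ∷ false ∷ zeros , false ∷ false ∷ true ∷ zeros ,
  (λ ()) , (λ ()) , (λ ()) , (λ ()) , (λ ()) , (λ ()) , (λ ())

-- Ensures that the truncated subtraction in the dimension N - m - 1 is a true one.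
2+m≤2^m : ∀ {m} → 2 ≤ m → 2 + m ≤ 2 ^ m
2+m≤2^m (s≤s (s≤s {n = k} _)) = go k
  where
  go : ∀ k → 4 + k ≤ 2 ^ (2 + k)
  go zero    = ℕ.≤-refl
  go (suc k) = ℕ.+-mono-≤ {1} {2 ^ (2 + k)} {4 + k} (ℕ.m^n>0 2 (2 + k)) (ℕ.≤-trans (go k) (ℕ.m≤m+n (2 ^ (2 + k)) 0))

-- The cases of the theorem.

module Main {m : ℕ} (4≤m : 4 ≤ m) (even : m % 2 ≡ 0) (α : Word m) (α-primitive : IsPrimitive α) where

  N : ℕ
  N = 2 ^ m ∸ 1

  3≤m : 3 ≤ m
  3≤m = ℕ.<⇒≤ 4≤m

  1≤m : 1 ≤ m
  1≤m = ℕ.≤-trans (s≤s z≤n) 4≤m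

  extendedColumn : ∀ i₁ i₂ → Fin N → Word (suc m)
  extendedColumn i₁ i₂ i = lookup (vRow α i₁ i₂) i ∷ hcol α i

  column-row : ∀ {i₁ i₂ a b c} → RowOf i₁ i₂ a b c → ∀ i → extendedColumn i₁ i₂ i ≡ v a b c (hcol α i) ∷ hcol α i
  column-row row i = cong (_∷ hcol α i) (trans (lookup∘tabulate _ i) (value row (hcol α i)))

  module Row {i₁ i₂ a b c} (row : RowOf i₁ i₂ a b c) (nonlinear : a ∨ c ≡ true) =
    Extended (hcol α) (hcol≢zeros 1≤m α α-primitive) (hcol-injective 1≤m α α-primitive)
      (hcol-surjective 1≤m α α-primitive)
      (proj₁ (hcol-surjective 1≤m α α-primitive oneF (oneF≢zeros 1≤m)))
      even a b c nonlinear 3≤m (extendedColumn i₁ i₂) (column-row row)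

  -- With a = c = 1, κ is 1 + B and the crossing columns are the orthogonal ones other than h i.
  -- Their number 2^(m-1) - 2 equals (N - 3)/2 because N - 3 = 2^m - 4.
  case-orthogonal : ∀ {i₁ i₂ b} → RowOf i₁ i₂ true b true →
    NonAntipodal (codeC α i₁ i₂) × CompletelyTransitive (codeC α i₁ i₂) × coveringRadius (codeC α i₁ i₂) ≡ 3
    × HasIntersectionArray (codeC α i₁ i₂) (N ∷ (N ∸ 3) / 2 ∷ 1 ∷ []) (1 ∷ (N ∸ 3) / 2 ∷ N ∷ [])
  case-orthogonal row = C-ones , completelyTransitive , coveringRadius≡3
    , intersectionArray ((N ∸ 3) / 2) (λ i → K≡ _ (count-cross-orthogonal refl refl i))
    where
    open Row row refl
    K≡ : ∀ K → (K + 2) * 2 ≡ 2 ^ m → K ≡ (N ∸ 3) / 2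
    K≡ K p = sym (begin
      (2 ^ m ∸ 1 ∸ 3) / 2    ≡⟨ cong (_/ 2) (ℕ.∸-+-assoc (2 ^ m) 1 3) ⟩
      (2 ^ m ∸ 4) / 2        ≡⟨ cong (λ x → (x ∸ 4) / 2) p ⟨
      ((K + 2) * 2 ∸ 4) / 2  ≡⟨ cong (λ x → (x ∸ 4) / 2) (ℕ.*-distribʳ-+ 2 K 2) ⟩
      (K * 2 + 4 ∸ 4) / 2    ≡⟨ cong (_/ 2) (ℕ.m+n∸n≡m (K * 2) 4) ⟩
      K * 2 / 2              ≡⟨ m*n/n≡m K 2 ⟩
      K                      ∎)
      where open ≡-Reasoning

  -- With a = 0 and c = 1, κ is B itself and the crossing columns are the 2^(m-1) = (N + 1)/2
  -- nonorthogonal ones.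
  case-nonorthogonal : ∀ {i₁ i₂ b} → RowOf i₁ i₂ false b true →
    Antipodal (codeC α i₁ i₂) × CompletelyTransitive (codeC α i₁ i₂) × coveringRadius (codeC α i₁ i₂) ≡ 3
    × HasIntersectionArray (codeC α i₁ i₂) (N ∷ (N + 1) / 2 ∷ 1 ∷ []) (1 ∷ (N + 1) / 2 ∷ N ∷ [])
  case-nonorthogonal row = C-ones , completelyTransitive , coveringRadius≡3
    , intersectionArray ((N + 1) / 2) (λ i → K≡ _ (count-cross-nonorthogonal refl refl i))
    where
    open Row row refl
    K≡ : ∀ K → K * 2 ≡ 2 ^ m → K ≡ (N + 1) / 2
    K≡ K p = sym (begin
      (2 ^ m ∸ 1 + 1) / 2  ≡⟨ cong (_/ 2) (ℕ.m∸n+n≡m (ℕ.m^n>0 2 m)) ⟩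
      2 ^ m / 2            ≡⟨ cong (_/ 2) p ⟨
      K * 2 / 2            ≡⟨ m*n/n≡m K 2 ⟩
      K                    ∎)
      where open ≡-Reasoning

  case-even : ∀ {i₁ i₂} → RowOf i₁ i₂ true true false →
    (∀ x → codeC α i₁ i₂ x ≡ evenHamming α x) × CompletelyTransitive (codeC α i₁ i₂)
    × IsNKD (codeC α i₁ i₂) (N ∸ m ∸ 1) 4 × coveringRadius (codeC α i₁ i₂) ≡ 3
  case-even {i₁} {i₂} row = code≡ , completelyTransitive , (dimension , minDistance) , coveringRadius≡3
    where
    open Row row refl
    open ≡-Reasoning
    code≡ : ∀ x → codeC α i₁ i₂ x ≡ evenHamming α x
    code≡ x = begin
      codeC α i₁ i₂ x                      ≡⟨ kernel-linear (hcol α) true true (extendedColumn i₁ i₂) (column-row row) x ⟩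
      not (e₁ x) ∧ hamming α x             ≡⟨ ∧-comm (not (e₁ x)) (hamming α x) ⟩
      hamming α x ∧ not (e₁ x)             ≡⟨ cong (hamming α x ∧_) (wt%2 x) ⟨
      hamming α x ∧ (wt x % 2 ≡ᵇ 0)        ∎
    1+m≤N : 1 + m ≤ N
    1+m≤N = ℕ.∸-monoˡ-≤ 1 (2+m≤2^m (ℕ.≤-trans (s≤s (s≤s z≤n)) 4≤m))
    dimension : size (codeC α i₁ i₂) ≡ 2 ^ (N ∸ m ∸ 1)
    dimension = ℕ.*-cancelʳ-≡ _ _ (2 ^ suc m) {{ℕ.m^n≢0 2 (suc m)}} (begin
      size (codeC α i₁ i₂) * 2 ^ suc m   ≡⟨ size≡ ⟩
      2 ^ N                              ≡⟨ cong (2 ^_) (ℕ.m∸n+n≡m 1+m≤N) ⟨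
      2 ^ (N ∸ suc m + suc m)            ≡⟨ ℕ.^-distribˡ-+-* 2 (N ∸ suc m) (suc m) ⟩
      2 ^ (N ∸ suc m) * 2 ^ suc m        ≡⟨ cong (λ d → 2 ^ d * 2 ^ suc m) (trans (ℕ.∸-+-assoc N m 1) (cong (N ∸_) (ℕ.+-comm m 1))) ⟨
      2 ^ (N ∸ m ∸ 1) * 2 ^ suc m        ∎)
    minDistance : MinDistance (codeC α i₁ i₂) 4
    minDistance with x , y , z , x≢0 , y≢0 , z≢0 , t≢0 , x≢y , x≢z , x≢t ← independentWords 3≤m =
      -- For a = 1 and c = 0, κ reduces to `true`. The words x, y, z are the first three unit
      -- vectors.
      minDistance≡4 (λ _ _ → refl) x y z x≢0 y≢0 z≢0 t≢0 x≢y x≢z x≢t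

  case-hamming : ∀ {i₁ i₂} → RowOf i₁ i₂ false true false → ∀ x → codeC α i₁ i₂ x ≡ hamming α x
  case-hamming {i₁} {i₂} row = kernel-linear (hcol α) false true (extendedColumn i₁ i₂) (column-row row)

theorem2p3 : (m : ℕ) → 4 ≤ m → m % 2 ≡ 0 →
    (c : Word m) → IsPrimitive c →
    (i₁ i₂ : ℕ) → i₁ < 4 → i₂ < 4 → i₁ ≢ i₂ →
    ((PairIs i₁ i₂ 0 1 ⊎ PairIs i₁ i₂ 0 3) →
    NonAntipodal (codeC c i₁ i₂) × CompletelyTransitive (codeC c i₁ i₂)
    × coveringRadius (codeC c i₁ i₂) ≡ 3
    × HasIntersectionArray (codeC c i₁ i₂)
    ((2 ^ m ∸ 1) ∷ ((2 ^ m ∸ 1) ∸ 3) / 2 ∷ 1 ∷ [])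
    (1 ∷ ((2 ^ m ∸ 1) ∸ 3) / 2 ∷ (2 ^ m ∸ 1) ∷ []))
    × ((PairIs i₁ i₂ 1 2 ⊎ PairIs i₁ i₂ 2 3) →
    Antipodal (codeC c i₁ i₂) × CompletelyTransitive (codeC c i₁ i₂)
    × coveringRadius (codeC c i₁ i₂) ≡ 3
    × HasIntersectionArray (codeC c i₁ i₂)
    ((2 ^ m ∸ 1) ∷ ((2 ^ m ∸ 1) + 1) / 2 ∷ 1 ∷ [])
    (1 ∷ ((2 ^ m ∸ 1) + 1) / 2 ∷ (2 ^ m ∸ 1) ∷ []))
    × (PairIs i₁ i₂ 0 2 →
    (∀ (x : Word (2 ^ m ∸ 1)) → codeC c i₁ i₂ x ≡ evenHamming c x)
    × CompletelyTransitive (codeC c i₁ i₂)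
    × IsNKD (codeC c i₁ i₂) ((2 ^ m ∸ 1) ∸ m ∸ 1) 4
    × coveringRadius (codeC c i₁ i₂) ≡ 3)
    × (PairIs i₁ i₂ 1 3 →
    ∀ (x : Word (2 ^ m ∸ 1)) → codeC c i₁ i₂ x ≡ hamming c x)
theorem2p3 m 4≤m even c c-primitive i₁ i₂ _ _ _ =
    (λ { (inj₁ p) → case-orthogonal (row-pair row₀₁ p) ; (inj₂ p) → case-orthogonal (row-pair row₀₃ p) })
  , (λ { (inj₁ p) → case-nonorthogonal (row-pair row₁₂ p) ; (inj₂ p) → case-nonorthogonal (row-pair row₂₃ p) })
  , (λ p → case-even (row-pair row₀₂ p))
  , (λ p → case-hamming (row-pair row₁₃ p))
  where open Main 4≤m even c c-primitive
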